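{- Let $t,n$ be positive integers with $t<n$. Then $$pw(H(t,2,n)) = bw(H(t,2,n)) = \sum_{k = \lfloor (n-t)/2 \rfloor }^{\lfloor (n-t)/2 \rfloor +t -1} \binom{n}{k} + \sum_{a=0}^{\lfloor (n-t-1)/2 \rfloor } \left( \binom{t+2a}{t+a-1} - \binom{t+2a}{a-1} \right).$$
   Context: $H(t,2,n)$ is the graph whose vertices are all binary vectors of length $n$, two distinct vectors being adjacent iff their Hamming distance is at most $t$. $pw(G)$ is the pathwidth of $G$: the minimum over path decompositions of (maximum bag size minus 1). $bw(G)$ is the bandwidth of a graph $G=(V,E)$: $bw(G)=\min_{\phi}\max_{uv\in E}|\phi(u)-\phi(v)|$, the minimum over all bijections $\phi:V\to\{1,\dots,|V|\}$. Convention: $\binom{x}{y}=0$ if $y<0$ or $y>x$. -}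

module Defs where

open import Data.Bool using (Bool; _≟_)
open import Data.Fin as Fin using (Fin; toℕ)
open import Data.Fin.Properties using (1↔⊤; 2↔Bool; *↔×)
open import Data.Fin.Subset using (Subset; _∈_; ∣_∣)
open import Data.Integer as ℤ using (ℤ; +_; -[1+_]; 0ℤ; 1ℤ)
open import Data.List using (List; foldr; map; applyUpTo)
open import Data.Nat using (ℕ; zero; suc; _+_; _*_; _∸_; _^_; _/_; _≤_; ∣_-_∣)
open import Data.Nat.Combinatorics using (_C_)
open import Data.Product using (_×_; _,_; ∃; ∃-syntax; proj₁; uncurry)
open import Data.Product.Function.NonDependent.Propositional using (_×-↔_)
open import Data.Unit using (⊤; tt)
open import Data.Vec using (Vec; []; _∷_; zip; count)
open import Function using (_∘_; _⤖_; _↔_; mk↔ₛ′; module Bijection)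
open import Function.Construct.Composition using (_↔-∘_)
open import Function.Construct.Symmetry using (↔-sym)
open import Function.Properties.Inverse using (↔⇒⤖)
open import Level using (0ℓ)
open import Relation.Binary using (Rel; Symmetric; Irreflexive)
open import Relation.Binary.PropositionalEquality using (_≡_; _≢_; refl; sym; cong; subst)
open import Relation.Nullary using (¬?)

IsMin : (ℕ → Set) → ℕ → Set
IsMin P m = P m × (∀ k → P k → m ≤ k)

IsMax : (ℕ → Set) → ℕ → Set
IsMax P m = P m × (∀ k → P k → k ≤ m)

-- Finite simple graphs.  The enumeration only witnesses |V| = order, and lets
-- sets of vertices be represented by the library's Subset order.
record FiniteGraph : Set₁ where
  field
    Vertex      : Set
    order       : ℕ
    enumeration : Vertex ⤖ Fin order
    _~_         : Rel Vertex 0ℓ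
    ~-sym       : Symmetric _~_
    ~-irrefl    : Irreflexive _≡_ _~_

  VertexSet : Set
  VertexSet = Subset order

  infix 4 _∈ᵥ_
  _∈ᵥ_ : Vertex → VertexSet → Set
  v ∈ᵥ X = Bijection.to enumeration v ∈ X

module _ (G : FiniteGraph) where
  open FiniteGraph G

  record PathDecomposition : Set where
    field
      length       : ℕ
      bag          : Fin length → VertexSet
      vertex-cover : ∀ v → ∃[ i ] v ∈ᵥ bag i
      edge-cover   : ∀ {u v} → u ~ v → ∃[ i ] (u ∈ᵥ bag i × v ∈ᵥ bag i)
      consecutive  : ∀ {v i j k} → i Fin.≤ j → j Fin.≤ k →
                     v ∈ᵥ bag i → v ∈ᵥ bag k → v ∈ᵥ bag j

  -- Width w means that the largest bag has w + 1 elements.  (Only for the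
  -- graph without vertices is no such natural number w available.)
  HasWidth : PathDecomposition → ℕ → Set
  HasWidth D w = IsMax (λ s → ∃[ i ] s ≡ ∣ bag i ∣) (suc w)
    where open PathDecomposition D

  IsPathwidth : ℕ → Set
  IsPathwidth = IsMin (λ w → ∃[ D ] HasWidth D w)

  -- Labels run over 0, …, order - 1 instead of 1, …, order, which leaves all
  -- differences unchanged.
  Labelling : Set
  Labelling = Vertex ⤖ Fin order

  edgeLength : Labelling → Vertex → Vertex → ℕ
  edgeLength φ u v = ∣ toℕ (to u) - toℕ (to v) ∣
    where open Bijection φ using (to)

  -- The maximum is over edges, so it does not exist for an edgeless graph.
  HasStretch : Labelling → ℕ → Set
  HasStretch φ = IsMax (λ d → ∃[ u ] ∃[ v ] (u ~ v × d ≡ edgeLength φ u v))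

  IsBandwidth : ℕ → Set
  IsBandwidth = IsMin (λ b → ∃[ φ ] HasStretch φ b)

hamming : ∀ {n} → Vec Bool n → Vec Bool n → ℕ
hamming u v = count (¬? ∘ uncurry _≟_) (zip u v)

hamming-sym : ∀ {n} (u v : Vec Bool n) → hamming u v ≡ hamming v u
hamming-sym []               []               = refl
hamming-sym (Bool.false ∷ u) (Bool.false ∷ v) = hamming-sym u v
hamming-sym (Bool.false ∷ u) (Bool.true  ∷ v) = cong suc (hamming-sym u v)
hamming-sym (Bool.true  ∷ u) (Bool.false ∷ v) = cong suc (hamming-sym u v)
hamming-sym (Bool.true  ∷ u) (Bool.true  ∷ v) = hamming-sym u v

Vec[]↔⊤ : Vec Bool 0 ↔ ⊤
Vec[]↔⊤ = mk↔ₛ′ (λ _ → tt) (λ _ → []) (λ _ → refl) (λ { [] → refl })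

Vec∷↔× : ∀ {n} → Vec Bool (suc n) ↔ (Bool × Vec Bool n)
Vec∷↔× = mk↔ₛ′ (λ { (b ∷ v) → b , v }) (λ { (b , v) → b ∷ v })
               (λ _ → refl) (λ { (_ ∷ _) → refl })

binaryVectors↔ : ∀ n → Vec Bool n ↔ Fin (2 ^ n)
binaryVectors↔ zero    = ↔-sym 1↔⊤ ↔-∘ Vec[]↔⊤
binaryVectors↔ (suc n) =
  ↔-sym *↔× ↔-∘ ((↔-sym 2↔Bool ×-↔ binaryVectors↔ n) ↔-∘ Vec∷↔×)

-- The graph H(t,2,n).
H₂ : ℕ → ℕ → FiniteGraph
H₂ t n = record
  { Vertex      = Vec Bool n
  ; order       = 2 ^ n
  ; enumeration = ↔⇒⤖ (binaryVectors↔ n)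
  ; _~_         = λ u v → u ≢ v × hamming u v ≤ t
  ; ~-sym       = λ {u} {v} (u≢v , d≤t) →
                    (u≢v ∘ sym) , subst (_≤ t) (hamming-sym u v) d≤t
  ; ~-irrefl    = λ u≡v u~v → proj₁ u~v u≡v
  }

-- Integer lower index, so that C(x, y) = 0 for y < 0 as well as for y > x.
binom : ℕ → ℤ → ℤ
binom x (+ y)    = + (x C y)
binom x -[1+ _ ] = 0ℤ

-- Σ_{k = lo}^{hi} f k, both ends included.
∑ : ℕ → ℕ → (ℕ → ℤ) → ℤ
∑ lo hi f = foldr ℤ._+_ 0ℤ (map f (applyUpTo (λ i → lo + i) (suc hi ∸ lo)))

syntax ∑ lo hi (λ k → e) = ∑[ k from lo to hi ] e
infixr 6 ∑

-- For 0 < t < n, no truncated subtraction here actually truncates.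
widthFormula : ℕ → ℕ → ℤ
widthFormula t n =
  (∑[ k from (n ∸ t) / 2 to ((n ∸ t) / 2 + t ∸ 1) ] binom n (+ k))
  ℤ.+
  (∑[ a from 0 to ((n ∸ t ∸ 1) / 2) ]
    (binom (t + 2 * a) (+ (t + a) ℤ.- 1ℤ) ℤ.- binom (t + 2 * a) (+ a ℤ.- 1ℤ)))

{-# OPTIONS --safe #-}
module Submission where

open import Defs
open import Algebra.Properties.CommutativeSemigroup using (interchange)
open import Data.Bool using (Bool; true; false; not; _∨_; T; if_then_else_) renaming (_≟_ to _≟ᵇ_)
open import Data.Bool.Properties using (T?; T-≡; T-∨; ∨-assoc; ∨-comm)
open import Data.Fin as Fin using (Fin; zero; suc; toℕ; fromℕ<)
import Data.Fin.Properties as Fin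
open import Data.Fin.Subset using (Subset; _∈_; ∣_∣)
import Data.Integer as ℤ
import Data.Integer.Properties as ℤ
import Data.Integer.Tactic.RingSolver as ℤ-solve
open import Data.List as List using (foldr; applyUpTo)
open import Data.Nat
open import Data.Nat.Combinatorics using (_C_; nCk≡nC[n∸k]; nCk+nC[k+1]≡[n+1]C[k+1]; k>n⇒nCk≡0; nCn≡1)
open import Data.Nat.DivMod using (m/n≡1+[m∸n]/n)
open import Data.Nat.Properties
open import Data.Nat.Tactic.RingSolver using (solve-∀)
open import Data.Product using (_×_; _,_; ∃; ∃-syntax; proj₁; proj₂)
open import Data.Sum using (_⊎_; inj₁; inj₂; [_,_]′)
open import Data.Vec using (Vec; []; _∷_; _++_; lookup; map; splitAt; tabulate; tail; insertAt; removeAt)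
open import Data.Vec.Properties using (∷-injectiveʳ; []=⇒lookup; lookup⇒[]=; lookup-++ˡ; lookup-++ʳ; lookup∘tabulate; insertAt-lookup; insertAt-removeAt; removeAt-insertAt)
open import Function using (_∘_; id; Injective; module Equivalence; module Inverse; module Bijection; mk⤖)
open import Relation.Binary using (tri<; tri≈; tri>)
open import Relation.Binary.PropositionalEquality
open import Relation.Nullary using (Dec; yes; no; ¬_; contradiction)
open import Relation.Nullary.Decidable using (map′; _×-dec_; _⊎-dec_; ¬?; decidable-stable; ⌊_⌋; toWitness; fromWitness)

-- Number the points of the cube along Harper's simplicial order.  The rank of a
-- point is a sum over its suffixes of ball sizes determined by their weights, so
-- for two points at distance ≤ t the ranks differ by at most a sum of t consecutive
-- binomial coefficients per suffix.  Taking these windows central bounds the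
-- bandwidth, and some edge attains all of the bounds at once.
--
-- For the lower bound, Harper's theorem (proved by compression along coordinates)
-- says that the closed neighbourhood of a set is at least as large as that of the
-- initial segment of the same size, which is again an initial segment.  Applied t
-- times to a set of size m, with the source of the extremal edge at position m, it
-- yields an outer boundary as large as the length of this edge.  In a path
-- decomposition take a set of m points that contains all points first occurring
-- after some bag and none first occurring before it: its outer boundary, together
-- with a point of the set, lies in that bag.  Conversely, the intervals of k + 1
-- consecutive labels of a labelling with stretch k form a path decomposition of
-- width k, which transfers the lower bound to the bandwidth.

-- Families of points of the cube and their sizes

Family : ℕ → Set
Family n = Vec Bool n → Bool

⟦_⟧ : Bool → ℕ
⟦ b ⟧ = if b then 1 else 0

total : ∀ {n} → (Vec Bool n → ℕ) → ℕ
total {zero}  f = f []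
total {suc n} f = total (f ∘ (false ∷_)) + total (f ∘ (true ∷_))

card : ∀ {n} → Family n → ℕ
card S = total (⟦_⟧ ∘ S)

private variable
  n : ℕ

T⇒⟦⟧≡1 : ∀ {b} → T b → ⟦ b ⟧ ≡ 1
T⇒⟦⟧≡1 {true} _ = refl

¬T⇒⟦⟧≡0 : ∀ {b} → ¬ T b → ⟦ b ⟧ ≡ 0
¬T⇒⟦⟧≡0 {true}  ¬t = contradiction _ ¬t
¬T⇒⟦⟧≡0 {false} _  = refl

⟦⟧-mono : ∀ {b c} → (T b → T c) → ⟦ b ⟧ ≤ ⟦ c ⟧
⟦⟧-mono {false}        _   = z≤n
⟦⟧-mono {true} {true}  _   = ≤-refl
⟦⟧-mono {true} {false} b⇒c = contradiction (b⇒c _) id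

anyVec? : {P : Vec Bool n → Set} → (∀ x → Dec (P x)) → Dec (∃ P)
anyVec? {zero}  P? = map′ ([] ,_) (λ { ([] , p) → p }) (P? [])
anyVec? {suc n} P? =
  map′ [ (λ (x , p) → false ∷ x , p) , (λ (x , p) → true ∷ x , p) ]′
       (λ { (false ∷ x , p) → inj₁ (x , p) ; (true ∷ x , p) → inj₂ (x , p) })
       (anyVec? (λ x → P? (false ∷ x)) ⊎-dec anyVec? (λ x → P? (true ∷ x)))

total-mono : {f g : Vec Bool n → ℕ} → (∀ x → f x ≤ g x) → total f ≤ total g
total-mono {zero}  f≤g = f≤g []
total-mono {suc n} f≤g = +-mono-≤ (total-mono λ x → f≤g (false ∷ x)) (total-mono λ x → f≤g (true ∷ x))

total-mono-< : {f g : Vec Bool n → ℕ} → (∀ x → f x ≤ g x) → ∀ x → f x < g x → total f < total g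
total-mono-< f≤g []          fx<gx = fx<gx
total-mono-< f≤g (false ∷ x) fx<gx =
  +-mono-<-≤ (total-mono-< (λ z → f≤g (false ∷ z)) x fx<gx) (total-mono λ z → f≤g (true ∷ z))
total-mono-< f≤g (true ∷ x)  fx<gx =
  +-mono-≤-< (total-mono λ z → f≤g (false ∷ z)) (total-mono-< (λ z → f≤g (true ∷ z)) x fx<gx)

total-cong : {f g : Vec Bool n → ℕ} → (∀ x → f x ≡ g x) → total f ≡ total g
total-cong {zero}  f≡g = f≡g []
total-cong {suc n} f≡g = cong₂ _+_ (total-cong λ x → f≡g (false ∷ x)) (total-cong λ x → f≡g (true ∷ x))

total-+ : (f g : Vec Bool n → ℕ) → total (λ x → f x + g x) ≡ total f + total g
total-+ {zero}  f g = refl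
total-+ {suc n} f g = trans
  (cong₂ _+_ (total-+ (f ∘ (false ∷_)) (g ∘ (false ∷_))) (total-+ (f ∘ (true ∷_)) (g ∘ (true ∷_))))
  (interchange +-commutativeSemigroup (total (f ∘ (false ∷_))) (total (g ∘ (false ∷_))) _ _)

total-*ʳ : (f : Vec Bool n → ℕ) → ∀ k → total (λ x → f x * k) ≡ total f * k
total-*ʳ {zero}  f k = refl
total-*ʳ {suc n} f k = trans
  (cong₂ _+_ (total-*ʳ (f ∘ (false ∷_)) k) (total-*ʳ (f ∘ (true ∷_)) k))
  (sym (*-distribʳ-+ k (total (f ∘ (false ∷_))) _))

total-insertAt : (f : Vec Bool (suc n) → ℕ) → ∀ i →
  total f ≡ total (λ x → f (insertAt x i false)) + total (λ x → f (insertAt x i true))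
total-insertAt {n}     f zero    = refl
total-insertAt {suc n} f (suc i) = trans
  (cong₂ _+_ (total-insertAt (f ∘ (false ∷_)) i) (total-insertAt (f ∘ (true ∷_)) i))
  (interchange +-commutativeSemigroup (total (λ x → f (false ∷ insertAt x i false))) _ _ _)

card-mono : {S S′ : Family n} → (∀ x → T (S x) → T (S′ x)) → card S ≤ card S′
card-mono S⊆S′ = total-mono λ x → ⟦⟧-mono (S⊆S′ x)

card-mono-< : {S S′ : Family n} → (∀ x → T (S x) → T (S′ x)) →
              ∀ x → ¬ T (S x) → T (S′ x) → card S < card S′
card-mono-< {S = S} {S′} S⊆S′ x x∉S x∈S′ = total-mono-< (λ z → ⟦⟧-mono (S⊆S′ z)) x
  (≤-reflexive (trans (cong suc (¬T⇒⟦⟧≡0 x∉S)) (sym (T⇒⟦⟧≡1 {S′ x} x∈S′))))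

card-full : card {n} (λ _ → true) ≡ 2 ^ n
card-full {zero}  = refl
card-full {suc n} = cong₂ _+_ (card-full {n}) (trans (card-full {n}) (sym (+-identityʳ _)))

card≤2^n : (S : Family n) → card S ≤ 2 ^ n
card≤2^n {n} S = ≤-trans (card-mono {S = S} {S′ = λ _ → true} _) (≤-reflexive (card-full {n}))

card-empty : {S : Family n} → (∀ x → ¬ T (S x)) → card S ≡ 0
card-empty {zero}  ∉S = ¬T⇒⟦⟧≡0 (∉S [])
card-empty {suc n} ∉S = cong₂ _+_ (card-empty λ x → ∉S (false ∷ x)) (card-empty λ x → ∉S (true ∷ x))

card-subsingleton : {S : Family n} → (∀ x y → T (S x) → T (S y) → x ≡ y) → card S ≤ 1
card-subsingleton {zero} {S} _ = ⟦⟧-mono {S []} {true} _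
card-subsingleton {suc n} {S} unique with anyVec? (λ x → T? (S (false ∷ x)))
... | no ∉S₀ rewrite card-empty {S = S ∘ (false ∷_)} (λ x x∈S → ∉S₀ (x , x∈S)) =
  card-subsingleton λ x y x∈S y∈S → ∷-injectiveʳ (unique (true ∷ x) (true ∷ y) x∈S y∈S)
... | yes (x , x∈S)
  rewrite card-empty {S = S ∘ (true ∷_)} (λ y y∈S → contradiction (unique (false ∷ x) (true ∷ y) x∈S y∈S) λ ())
        | +-identityʳ (card (S ∘ (false ∷_))) =
  card-subsingleton λ y z y∈S z∈S → ∷-injectiveʳ (unique (false ∷ y) (false ∷ z) y∈S z∈S)

-- Serves both `rank` and the labels of an arbitrary labelling.
module Counting (f : Vec Bool n → ℕ) (f-inj : Injective _≡_ _≡_ f) (f<2^n : ∀ x → f x < 2 ^ n) where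

  below : ℕ → Family n
  below m x = f x <ᵇ m

  card-below-suc : ∀ m → card (below (suc m)) ≤ suc (card (below m))
  card-below-suc m = begin
    card (below (suc m))                                    ≤⟨ total-mono split ⟩
    total (λ x → ⟦ below m x ⟧ + ⟦ f x ≡ᵇ m ⟧)              ≡⟨ total-+ (⟦_⟧ ∘ below m) _ ⟩
    card (below m) + card (λ x → f x ≡ᵇ m)                  ≤⟨ +-monoʳ-≤ _ (card-subsingleton unique) ⟩
    card (below m) + 1                                      ≡⟨ +-comm _ 1 ⟩
    suc (card (below m))                                    ∎
    where
    open ≤-Reasoning
    unique : ∀ x y → T (f x ≡ᵇ m) → T (f y ≡ᵇ m) → x ≡ y
    unique x y p q = f-inj (trans (≡ᵇ⇒≡ _ m p) (sym (≡ᵇ⇒≡ _ m q)))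
    split : ∀ x → ⟦ below (suc m) x ⟧ ≤ ⟦ below m x ⟧ + ⟦ f x ≡ᵇ m ⟧
    split x with T? (f x <ᵇ suc m)
    ... | no fx≮ rewrite ¬T⇒⟦⟧≡0 fx≮ = z≤n
    ... | yes fx< rewrite T⇒⟦⟧≡1 fx< with m≤n⇒m<n∨m≡n (s≤s⁻¹ (<ᵇ⇒< (f x) _ fx<))
    ... | inj₁ fx<m rewrite T⇒⟦⟧≡1 (<⇒<ᵇ fx<m) = s≤s z≤n
    ... | inj₂ fx≡m rewrite T⇒⟦⟧≡1 (≡⇒≡ᵇ _ _ fx≡m) = m≤n+m 1 _

  card-below-≤ : ∀ m → card (below m) ≤ m
  card-below-≤ zero    = ≤-reflexive (card-empty {S = below 0} λ _ ())
  card-below-≤ (suc m) = ≤-trans (card-below-suc m) (s≤s (card-below-≤ m))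

  card-below-+ : ∀ m d → card (below (m + d)) ≤ card (below m) + d
  card-below-+ m zero    = ≤-reflexive (trans (cong (card ∘ below) (+-identityʳ m)) (sym (+-identityʳ _)))
  card-below-+ m (suc d) rewrite +-suc m d | +-suc (card (below m)) d =
    ≤-trans (card-below-suc (m + d)) (s≤s (card-below-+ m d))

  -- By injectivity each further label adds at most one point, and all points are reached at
  -- `2 ^ n`, so no step up to there can fail to add one.
  card-below : ∀ {m} → m ≤ 2 ^ n → card (below m) ≡ m
  card-below {m} m≤ = ≤-antisym (card-below-≤ m) (+-cancelʳ-≤ (2 ^ n ∸ m) _ _ (begin
    m + (2 ^ n ∸ m)                ≡⟨ m+[n∸m]≡n m≤ ⟩
    2 ^ n                          ≡⟨ card-full {n} ⟨
    card {n} (λ _ → true)          ≤⟨ card-mono (λ x _ → <⇒<ᵇ (<-≤-trans (f<2^n x) (≤-reflexive (sym (m+[n∸m]≡n m≤))))) ⟩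
    card (below (m + (2 ^ n ∸ m))) ≤⟨ card-below-+ m _ ⟩
    card (below m) + (2 ^ n ∸ m)   ∎))
    where open ≤-Reasoning

  surjective : ∀ {m} → m < 2 ^ n → ∃[ x ] f x ≡ m
  surjective {m} m< with anyVec? (λ x → f x ≟ m)
  ... | yes found = found
  ... | no ∄ = contradiction (begin-strict
    m                    <⟨ n<1+n m ⟩
    suc m                ≡⟨ card-below m< ⟨
    card (below (suc m)) ≤⟨ card-mono below⊆ ⟩
    card (below m)       ≤⟨ card-below-≤ m ⟩
    m                    ∎) (<-irrefl refl)
    where
    open ≤-Reasoning
    below⊆ : ∀ x → T (below (suc m) x) → T (below m x)
    below⊆ x x∈ = <⇒<ᵇ (≤∧≢⇒< (s≤s⁻¹ (<ᵇ⇒< (f x) _ x∈)) (λ eq → ∄ (x , eq)))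

-- Windows of consecutive binomial coefficients

nC0≡1 : ∀ k → k C 0 ≡ 1
nC0≡1 k = trans (nCk≡nC[n∸k] {k = 0} {n = k} z≤n) (nCn≡1 k)

C-sym : ∀ {k} j l → j + l ≡ k → k C j ≡ k C l
C-sym j l refl = trans (nCk≡nC[n∸k] (m≤m+n j l)) (cong ((j + l) C_) (m+n∸m≡n j l))

-- The hypotheses say that `l` is at least as close to the middle of the row as `j`. Pascal's rule
-- reduces the claim to a comparison of two pairs of entries in the row above.
C-increasing : ∀ k {j l} → j ≤ l → j + l ≤ k → k C j ≤ k C l
C-increasing zero    z≤n z≤n = ≤-refl
C-increasing (suc k) {zero} {zero} z≤n _ = ≤-refl
C-increasing (suc k) {zero} {suc l} z≤n l<k = begin
  suc k C 0         ≡⟨ trans (nC0≡1 (suc k)) (sym (nC0≡1 k)) ⟩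
  k C 0             ≤⟨ C-increasing k z≤n (s≤s⁻¹ l<k) ⟩
  k C l             ≤⟨ m≤m+n _ _ ⟩
  k C l + k C suc l ≡⟨ nCk+nC[k+1]≡[n+1]C[k+1] k l ⟩
  suc k C suc l     ∎
  where open ≤-Reasoning
C-increasing (suc k) {suc j} {suc l} (s≤s j≤l) j+l<k = begin
  suc k C suc j     ≡⟨ nCk+nC[k+1]≡[n+1]C[k+1] k j ⟨
  k C j + k C suc j ≤⟨ step ⟩
  k C l + k C suc l ≡⟨ nCk+nC[k+1]≡[n+1]C[k+1] k l ⟩
  suc k C suc l     ∎
  where
  open ≤-Reasoning
  j+1+l≤k : j + suc l ≤ k
  j+1+l≤k = s≤s⁻¹ j+l<k
  step : k C j + k C suc j ≤ k C l + k C suc l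
  step with m≤n⇒m<n∨m≡n j≤l
  ... | inj₂ refl = ≤-refl
  ... | inj₁ j<l with m≤n⇒m<n∨m≡n j+1+l≤k
  ...   | inj₁ j+l+1<k = +-mono-≤ (C-increasing k j≤l (≤-trans (+-monoʳ-≤ j (n≤1+n l)) j+1+l≤k))
                                 (C-increasing k (s≤s j≤l) j+l+1<k)
  -- Now `suc l` is further from the middle than `suc j`, so the summands are matched crosswise:
  -- `k C j` equals `k C suc l` by symmetry, and `k C suc j` is at most `k C l`.
  ...   | inj₂ j+l+1≡k = begin
    k C j + k C suc j ≤⟨ +-mono-≤ (≤-reflexive (C-sym j (suc l) j+l+1≡k))
                                  (C-increasing k j<l (≤-trans (≤-reflexive (sym (+-suc j l))) j+1+l≤k)) ⟩
    k C suc l + k C l ≡⟨ +-comm (k C suc l) _ ⟩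
    k C l + k C suc l ∎

-- Reflection about the middle reduces this to `C-increasing`; beyond the end of the row the
-- coefficient is 0.
C-decreasing : ∀ k {j l} → j ≤ l → k ≤ j + l → k C l ≤ k C j
C-decreasing k {j} {l} j≤l k≤j+l with ≤-<-connex l k
... | inj₂ k<l rewrite k>n⇒nCk≡0 k<l = z≤n
... | inj₁ l≤k = begin
  k C l       ≡⟨ nCk≡nC[n∸k] l≤k ⟩
  k C (k ∸ l) ≤⟨ C-increasing k (∸-monoʳ-≤ k j≤l) (begin
    (k ∸ l) + (k ∸ j) ≤⟨ +-monoˡ-≤ (k ∸ j) (m≤n+o⇒m∸n≤o k l (≤-trans k≤j+l (≤-reflexive (+-comm j l)))) ⟩
    j + (k ∸ j)       ≡⟨ m+[n∸m]≡n (≤-trans j≤l l≤k) ⟩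
    k                 ∎) ⟩
  k C (k ∸ j) ≡⟨ nCk≡nC[n∸k] (≤-trans j≤l l≤k) ⟨
  k C j       ∎
  where open ≤-Reasoning

window : ℕ → ℕ → ℕ → ℕ
window k j zero    = 0
window k j (suc t) = window k j t + k C (j + t)

window-shift : ∀ k j t → window k j t + k C (j + t) ≡ k C j + window k (suc j) t
window-shift k j zero    = trans (cong (k C_) (+-identityʳ j)) (sym (+-identityʳ (k C j)))
window-shift k j (suc t) = begin
  window k j t + k C (j + t) + k C (j + suc t)     ≡⟨ cong₂ (λ a b → a + k C b) (window-shift k j t) (+-suc j t) ⟩
  k C j + window k (suc j) t + k C (suc j + t)     ≡⟨ +-assoc (k C j) _ _ ⟩
  k C j + (window k (suc j) t + k C (suc j + t))   ∎
  where open ≡-Reasoning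

window-increasing : ∀ k {j t} → j + (j + t) ≤ k → window k j t ≤ window k (suc j) t
window-increasing k {j} {t} h = +-cancelˡ-≤ (k C j) _ _ (begin
  k C j + window k j t         ≤⟨ +-monoˡ-≤ _ (C-increasing k (m≤m+n j t) h) ⟩
  k C (j + t) + window k j t   ≡⟨ +-comm (k C (j + t)) _ ⟩
  window k j t + k C (j + t)   ≡⟨ window-shift k j t ⟩
  k C j + window k (suc j) t   ∎)
  where open ≤-Reasoning

window-decreasing : ∀ k {j t} → k ≤ j + (j + t) → window k (suc j) t ≤ window k j t
window-decreasing k {j} {t} h = +-cancelˡ-≤ (k C j) _ _ (begin
  k C j + window k (suc j) t   ≡⟨ window-shift k j t ⟨
  window k j t + k C (j + t)   ≤⟨ +-monoʳ-≤ _ (C-decreasing k (m≤m+n j t) h) ⟩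
  window k j t + k C j         ≡⟨ +-comm _ (k C j) ⟩
  k C j + window k j t         ∎)
  where open ≤-Reasoning

-- The first and last index of a nonempty window of length `t` starting here add up to `k` or
-- `k - 1`. Truncation gives 0 when the window is longer than the row.
centre : ℕ → ℕ → ℕ
centre t k = ⌊ suc k ∸ t /2⌋

-- Shifting a window by one trades its first entry for a new last one, which is a gain before the
-- centre and a loss after it (or leaves the sum unchanged). The start moves to the centre in such
-- steps.
window≤central : ∀ k j t → window k j t ≤ window k (centre t k) t
window≤central k j t with ≤-total j (centre t k)
... | inj₁ j≤a = subst (λ a → window k j t ≤ window k a t) (m+[n∸m]≡n j≤a)
                       (climb (centre t k ∸ j) (≤-reflexive (m+[n∸m]≡n j≤a)))
  where
  open ≤-Reasoning
  below : ∀ i → i < centre t k → i + (i + t) ≤ k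
  below i i<a = s≤s⁻¹ (≤-pred (begin
    suc (suc (i + (i + t)))             ≡⟨ eq i t ⟩
    (suc i + suc i) + t                 ≤⟨ +-monoˡ-≤ t (+-mono-≤ i<a (≤-trans i<a (⌊n/2⌋≤⌈n/2⌉ (suc k ∸ t)))) ⟩
    (centre t k + ⌈ suc k ∸ t /2⌉) + t  ≡⟨ cong (_+ t) (⌊n/2⌋+⌈n/2⌉≡n (suc k ∸ t)) ⟩
    (suc k ∸ t) + t                     ≡⟨ m∸n+n≡m t≤k ⟩
    suc k                               ≤⟨ n≤1+n (suc k) ⟩
    suc (suc k)                         ∎))
    where
    eq : ∀ i t → suc (suc (i + (i + t))) ≡ (suc i + suc i) + t
    eq = solve-∀
    -- Otherwise the centre would be 0, and no start could lie below it.
    t≤k : t ≤ suc k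
    t≤k with ≤-total t (suc k)
    ... | inj₁ p = p
    ... | inj₂ q with m≤n⇒m∸n≡0 q
    ...   | z rewrite z = contradiction i<a λ ()
  climb : ∀ d → j + d ≤ centre t k → window k j t ≤ window k (j + d) t
  climb zero    _ rewrite +-identityʳ j = ≤-refl
  climb (suc d) h rewrite +-suc j d =
    ≤-trans (climb d (<⇒≤ h)) (window-increasing k {j + d} (below (j + d) h))
... | inj₂ a≤j = subst (λ j → window k j t ≤ window k (centre t k) t) (m+[n∸m]≡n a≤j) (descend (j ∸ centre t k))
  where
  open ≤-Reasoning
  a = centre t k
  above : ∀ d → k ≤ (a + d) + ((a + d) + t)
  above d = ≤-pred (begin
    suc k                       ≤⟨ m≤n+m∸n (suc k) t ⟩
    t + (suc k ∸ t)             ≡⟨ cong (t +_) (⌊n/2⌋+⌈n/2⌉≡n (suc k ∸ t)) ⟨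
    t + (a + ⌈ suc k ∸ t /2⌉)   ≤⟨ +-monoʳ-≤ t (+-monoʳ-≤ a (⌈n/2⌉≤1+⌊n/2⌋ (suc k ∸ t))) ⟩
    t + (a + suc a)             ≤⟨ m≤m+n _ (d + d) ⟩
    t + (a + suc a) + (d + d)   ≡⟨ eq t a d ⟩
    suc ((a + d) + ((a + d) + t)) ∎)
    where
    eq : ∀ t a d → t + (a + suc a) + (d + d) ≡ suc ((a + d) + ((a + d) + t))
    eq = solve-∀
    ⌈n/2⌉≤1+⌊n/2⌋ : ∀ n → ⌈ n /2⌉ ≤ suc ⌊ n /2⌋
    ⌈n/2⌉≤1+⌊n/2⌋ zero          = z≤n
    ⌈n/2⌉≤1+⌊n/2⌋ (suc zero)    = ≤-refl
    ⌈n/2⌉≤1+⌊n/2⌋ (suc (suc n)) = s≤s (⌈n/2⌉≤1+⌊n/2⌋ n)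
  descend : ∀ d → window k (a + d) t ≤ window k a t
  descend zero    rewrite +-identityʳ a = ≤-refl
  descend (suc d) = ≤-trans (subst (λ z → window k z t ≤ window k (a + d) t) (sym (+-suc a d))
                              (window-decreasing k {a + d} (above d))) (descend d)

-- The simplicial order

-- The number of points of weight < j in the k-dimensional cube.
ballSize : ℕ → ℕ → ℕ
ballSize _       zero    = 0
ballSize zero    (suc j) = 1
ballSize (suc k) (suc j) = ballSize k (suc j) + ballSize k j

ballSize-suc : ∀ k j → ballSize k (suc j) ≡ ballSize k j + k C j
ballSize-suc zero    zero    = refl
ballSize-suc zero    (suc j) = cong suc (sym (k>n⇒nCk≡0 {0} {suc j} z<s))
ballSize-suc (suc k) zero    = begin
  ballSize k 1 + 0      ≡⟨ +-identityʳ _ ⟩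
  ballSize k 1          ≡⟨ ballSize-suc k zero ⟩
  k C 0                 ≡⟨ trans (nC0≡1 k) (sym (nC0≡1 (suc k))) ⟩
  suc k C 0             ∎
  where open ≡-Reasoning
ballSize-suc (suc k) (suc j) = begin
  ballSize k (2 + j) + ballSize k (1 + j)
    ≡⟨ cong₂ _+_ (ballSize-suc k (suc j)) (ballSize-suc k j) ⟩
  (ballSize k (1 + j) + k C suc j) + (ballSize k j + k C j)
    ≡⟨ interchange +-commutativeSemigroup (ballSize k (1 + j)) _ _ _ ⟩
  (ballSize k (1 + j) + ballSize k j) + (k C suc j + k C j)
    ≡⟨ cong (λ c → ballSize k (1 + j) + ballSize k j + c) (trans (+-comm (k C suc j) _) (nCk+nC[k+1]≡[n+1]C[k+1] k j)) ⟩
  (ballSize k (1 + j) + ballSize k j) + suc k C suc j ∎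
  where open ≡-Reasoning

ballSize-window : ∀ k j t → ballSize k (j + t) ≡ ballSize k j + window k j t
ballSize-window k j zero    = trans (cong (ballSize k) (+-identityʳ j)) (sym (+-identityʳ _))
ballSize-window k j (suc t) rewrite +-suc j t = begin
  ballSize k (suc (j + t))                         ≡⟨ ballSize-suc k (j + t) ⟩
  ballSize k (j + t) + k C (j + t)                 ≡⟨ cong (_+ k C (j + t)) (ballSize-window k j t) ⟩
  ballSize k j + window k j t + k C (j + t)        ≡⟨ +-assoc (ballSize k j) _ _ ⟩
  ballSize k j + (window k j t + k C (j + t))      ∎
  where open ≡-Reasoning

ballSize-mono : ∀ k {i j} → i ≤ j → ballSize k i ≤ ballSize k j
ballSize-mono k {i} {j} i≤j = begin
  ballSize k i                       ≤⟨ m≤m+n _ _ ⟩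
  ballSize k i + window k i (j ∸ i)  ≡⟨ ballSize-window k i (j ∸ i) ⟨
  ballSize k (i + (j ∸ i))           ≡⟨ cong (ballSize k) (m+[n∸m]≡n i≤j) ⟩
  ballSize k j                       ∎
  where open ≤-Reasoning

ballSize-full : ∀ k {j} → k < j → ballSize k j ≡ 2 ^ k
ballSize-full zero    (s≤s _) = refl
ballSize-full (suc k) (s≤s k<j) = cong₂ _+_ (ballSize-full k (m≤n⇒m≤1+n k<j))
                                            (trans (ballSize-full k k<j) (sym (+-identityʳ _)))

ballSize≤2^n : ∀ k j → ballSize k j ≤ 2 ^ k
ballSize≤2^n k j = ≤-trans (ballSize-mono k {j} (m≤m+n j (suc k)))
                           (≤-reflexive (ballSize-full k {j + suc k} (m≤n+m (suc k) j)))

weight : Vec Bool n → ℕ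
weight []      = 0
weight (b ∷ x) = ⟦ b ⟧ + weight x

weight≤n : (x : Vec Bool n) → weight x ≤ n
weight≤n []          = z≤n
weight≤n (false ∷ x) = m≤n⇒m≤1+n (weight≤n x)
weight≤n (true ∷ x)  = s≤s (weight≤n x)

-- The position of a point in Harper's simplicial order, which compares points
-- lexicographically by the weights of their suffixes, the longest suffix first.
rank : Vec Bool n → ℕ
rank []              = 0
rank {suc n} (b ∷ x) = ballSize n (weight (b ∷ x)) + rank x

-- Together with `rank-upper`, this places the points of weight `w` in the block of ranks from
-- `ballSize n w` up to, but excluding, `ballSize n (suc w)`. The order thus sorts by weight first.
rank-lower : (x : Vec Bool n) → ballSize n (weight x) ≤ rank x
rank-lower []                  = ≤-refl
rank-lower {suc n} (true ∷ x)  = +-monoʳ-≤ _ (rank-lower x)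
rank-lower {suc n} (false ∷ x) with weight x | rank-lower x
... | zero  | _ = z≤n
... | suc w | h = +-monoʳ-≤ _ (≤-trans (ballSize-mono n (n≤1+n w)) h)

rank-upper : (x : Vec Bool n) → rank x < ballSize n (suc (weight x))
rank-upper []                  = ≤-refl
rank-upper {suc n} (true ∷ x)  = +-mono-≤-< (ballSize-mono n (n≤1+n (suc (weight x)))) (rank-upper x)
rank-upper {suc n} (false ∷ x) = <-≤-trans (+-monoʳ-< _ (rank-upper x)) (≤-reflexive (+-comm (ballSize n (weight x)) _))

rank<2^n : (x : Vec Bool n) → rank x < 2 ^ n
rank<2^n {n} x = <-≤-trans (rank-upper x) (ballSize≤2^n n (suc (weight x)))

weight-<⇒rank-< : {x y : Vec Bool n} → weight x < weight y → rank x < rank y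
weight-<⇒rank-< {n} {x} {y} h = <-≤-trans (rank-upper x) (≤-trans (ballSize-mono n h) (rank-lower y))

rank-≤⇒weight-≤ : {x y : Vec Bool n} → rank x ≤ rank y → weight x ≤ weight y
rank-≤⇒weight-≤ {x = x} {y} h = ≮⇒≥ λ wy<wx → <⇒≱ (weight-<⇒rank-< {x = y} {x} wy<wx) h

-- Equal weights give both ranks the same leading summand, so the tails decide.
rank-tail-≤ : (x y : Vec Bool (suc n)) → weight x ≡ weight y → rank (tail x) ≤ rank (tail y) → rank x ≤ rank y
rank-tail-≤ (b ∷ x) (c ∷ y) w≡ h rewrite w≡ = +-monoʳ-≤ _ h

rank-tail-< : (x y : Vec Bool (suc n)) → weight x ≡ weight y → rank (tail x) < rank (tail y) → rank x < rank y
rank-tail-< (b ∷ x) (c ∷ y) w≡ h rewrite w≡ = +-monoʳ-< _ h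

tail-rank-< : (x y : Vec Bool (suc n)) → weight x ≡ weight y → rank x < rank y → rank (tail x) < rank (tail y)
tail-rank-< (b ∷ x) (c ∷ y) w≡ h rewrite w≡ = +-cancelˡ-< _ _ _ h

⟦⟧-injective : ∀ {b c} → ⟦ b ⟧ ≡ ⟦ c ⟧ → b ≡ c
⟦⟧-injective {false} {false} _ = refl
⟦⟧-injective {true}  {true}  _ = refl

-- Equal ranks force equal weights, hence equal leading summands and equally ranked tails. Once the
-- tails agree, the weights determine the first bit.
rank-injective : Injective {A = Vec Bool n} _≡_ _≡_ rank
rank-injective {x = []} {[]} _ = refl
rank-injective {suc n} {x = b ∷ x} {c ∷ y} eq
  with w≡ ← ≤-antisym (rank-≤⇒weight-≤ {x = b ∷ x} {c ∷ y} (≤-reflexive eq))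
                      (rank-≤⇒weight-≤ {x = c ∷ y} {b ∷ x} (≤-reflexive (sym eq)))
  with refl ← rank-injective {x = x} {y} (+-cancelˡ-≡ (ballSize _ (weight (b ∷ x))) _ _
                 (trans eq (cong (λ w → ballSize n w + rank y) (sym w≡))))
  = cong (_∷ x) (⟦⟧-injective (+-cancelʳ-≡ (weight x) ⟦ b ⟧ ⟦ c ⟧ w≡))

module Rank {n} = Counting {n} rank rank-injective rank<2^n
open Rank using (below; card-below)

-- Rank differences across an edge

hamming-∷-≤ : ∀ b c (u v : Vec Bool n) → hamming u v ≤ hamming (b ∷ u) (c ∷ v)
hamming-∷-≤ false false u v = ≤-refl
hamming-∷-≤ false true  u v = n≤1+n _
hamming-∷-≤ true  false u v = n≤1+n _
hamming-∷-≤ true  true  u v = ≤-refl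

hamming-∷-same : ∀ b (u v : Vec Bool n) → hamming (b ∷ u) (b ∷ v) ≡ hamming u v
hamming-∷-same false u v = refl
hamming-∷-same true  u v = refl

weight≤weight+hamming : (u v : Vec Bool n) → weight v ≤ weight u + hamming u v
weight≤weight+hamming [] [] = z≤n
weight≤weight+hamming (false ∷ u) (false ∷ v) = weight≤weight+hamming u v
weight≤weight+hamming (false ∷ u) (true ∷ v)  =
  ≤-trans (s≤s (weight≤weight+hamming u v)) (≤-reflexive (sym (+-suc (weight u) _)))
weight≤weight+hamming (true ∷ u)  (false ∷ v) =
  m≤n⇒m≤1+n (≤-trans (weight≤weight+hamming u v) (+-monoʳ-≤ (weight u) (n≤1+n _)))
weight≤weight+hamming (true ∷ u)  (true ∷ v)  = s≤s (weight≤weight+hamming u v)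

-- One maximal window for each summand of `rank`; this total turns out to be both the pathwidth and
-- the bandwidth.
width : ℕ → ℕ → ℕ
width t zero    = 0
width t (suc n) = width t n + window n (centre t n) t

rank-≤-hamming : ∀ {t} (u v : Vec Bool n) → hamming u v ≤ t → rank v ≤ rank u + width t n
rank-≤-hamming [] [] _ = z≤n
rank-≤-hamming {suc n} {t} (b ∷ u) (c ∷ v) d≤t = begin
  ballSize n (weight (c ∷ v)) + rank v
    ≤⟨ +-mono-≤ (ballSize-mono n (≤-trans (weight≤weight+hamming (b ∷ u) (c ∷ v)) (+-monoʳ-≤ _ d≤t)))
                (rank-≤-hamming u v (≤-trans (hamming-∷-≤ b c u v) d≤t)) ⟩
  ballSize n (w + t) + (rank u + width t n)
    ≡⟨ cong (_+ _) (ballSize-window n w t) ⟩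
  ballSize n w + window n w t + (rank u + width t n)
    ≤⟨ +-monoˡ-≤ _ (+-monoʳ-≤ (ballSize n w) (window≤central n w t)) ⟩
  ballSize n w + window n (centre t n) t + (rank u + width t n)
    ≡⟨ eq (ballSize n w) _ _ _ ⟩
  ballSize n w + rank u + (width t n + window n (centre t n) t) ∎
  where
  open ≤-Reasoning
  w = weight (b ∷ u)
  eq : ∀ a b c d → a + b + (c + d) ≡ a + c + (d + b)
  eq = solve-∀

-- The weights are carried along so that a further leading bit can centre the next window. In
-- dimension `n ≤ t` they can differ by at most `n`, hence `n ⊓ t`.
record ExtremalEdge (t : ℕ) (n : ℕ) (w : ℕ) : Set where
  field
    source target : Vec Bool n
    near          : hamming source target ≤ t
    weight-source : weight source ≡ w
    weight-target : weight target ≡ w + n ⊓ t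
    rank-target   : rank target ≡ rank source + width t n

-- The endpoints are 0...0 and 1...1. In every dimension below `t` the central window starts at 0
-- and covers the whole row, so the jump from weight 0 to full weight attains it.
extremal-complete : ∀ t n → n ≤ t → ExtremalEdge t n 0
extremal-complete t zero    _   = record
  { source = [] ; target = [] ; near = z≤n ; weight-source = refl ; weight-target = refl ; rank-target = refl }
extremal-complete t (suc n) n<t = record
  { source        = false ∷ source
  ; target        = true ∷ target
  ; near          = ≤-trans (hamming≤n (false ∷ source) (true ∷ target)) n<t
  ; weight-source = weight-source
  ; weight-target = trans (cong suc (trans weight-target (m≤n⇒m⊓n≡m (<⇒≤ n<t)))) (sym (m≤n⇒m⊓n≡m n<t))
  ; rank-target   = begin
      ballSize n (suc (weight target)) + rank target
        ≡⟨ cong₂ (λ w r → ballSize n (suc w) + r) (trans weight-target (m≤n⇒m⊓n≡m (<⇒≤ n<t))) rank-target ⟩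
      ballSize n (suc n) + (rank source + width t n)
        -- Both `suc n` and `t` exceed `n`, so either ball is the whole cube.
        ≡⟨ cong (_+ (rank source + width t n)) (trans (ballSize-full n ≤-refl) (sym (ballSize-full n n<t))) ⟩
      ballSize n t + (rank source + width t n)
        ≡⟨ cong (_+ (rank source + width t n)) (ballSize-window n 0 t) ⟩
      window n 0 t + (rank source + width t n)
        ≡⟨ eq (window n 0 t) (rank source) (width t n) ⟩
      rank source + (width t n + window n 0 t)
        ≡⟨ cong (λ a → rank source + (width t n + window n a t)) (cong ⌊_/2⌋ (m≤n⇒m∸n≡0 n<t)) ⟨
      rank source + (width t n + window n (centre t n) t)
        ≡⟨ cong (λ w → ballSize n w + rank source + (width t n + window n (centre t n) t)) weight-source ⟨
      ballSize n (weight source) + rank source + (width t n + window n (centre t n) t) ∎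
  }
  where
  open ≡-Reasoning
  open ExtremalEdge (extremal-complete t n (<⇒≤ n<t))
  eq : ∀ a b c → a + (b + c) ≡ b + (c + a)
  eq = solve-∀
  hamming≤n : ∀ {n} (u v : Vec Bool n) → hamming u v ≤ n
  hamming≤n [] [] = z≤n
  hamming≤n (false ∷ u) (false ∷ v) = m≤n⇒m≤1+n (hamming≤n u v)
  hamming≤n (false ∷ u) (true ∷ v)  = s≤s (hamming≤n u v)
  hamming≤n (true ∷ u)  (false ∷ v) = s≤s (hamming≤n u v)
  hamming≤n (true ∷ u)  (true ∷ v)  = m≤n⇒m≤1+n (hamming≤n u v)

-- The bit by which the floor grows is the one prepended to both endpoints in `extremal`.
⌊1+n/2⌋-step : ∀ d → ∃[ b ] ⟦ b ⟧ + ⌊ d /2⌋ ≡ ⌊ suc d /2⌋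
⌊1+n/2⌋-step zero          = false , refl
⌊1+n/2⌋-step (suc zero)    = true , refl
⌊1+n/2⌋-step (suc (suc d)) with b , eq ← ⌊1+n/2⌋-step d =
  b , trans (+-suc ⟦ b ⟧ ⌊ d /2⌋) (cong suc eq)

-- A common alternating prefix before 0…0 and 1…1 makes the window of every suffix central.
extremal : ∀ t d → ExtremalEdge t (d + t) ⌊ d /2⌋
extremal t zero    = extremal-complete t t ≤-refl
extremal t (suc d) with b , b-eq ← ⌊1+n/2⌋-step d = record
  { source        = b ∷ source
  ; target        = b ∷ target
  ; near          = ≤-trans (≤-reflexive (hamming-∷-same b source target)) near
  ; weight-source = ws
  ; weight-target = trans wt (cong (a +_) (sym (m≥n⇒m⊓n≡n (m≤n+m t (suc d)))))
  ; rank-target   = begin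
      ballSize k (⟦ b ⟧ + weight target) + rank target
        ≡⟨ cong₂ (λ w r → ballSize k w + r) wt rank-target ⟩
      ballSize k (a + t) + (rank source + width t k)
        ≡⟨ cong (_+ (rank source + width t k)) (ballSize-window k a t) ⟩
      ballSize k a + window k a t + (rank source + width t k)
        ≡⟨ eq (ballSize k a) _ _ _ ⟩
      ballSize k a + rank source + (width t k + window k a t)
        ≡⟨ cong₂ (λ w c → ballSize k w + rank source + (width t k + window k c t)) (sym ws)
                 (cong ⌊_/2⌋ (sym (m+n∸n≡m (suc d) t))) ⟩
      ballSize k (⟦ b ⟧ + weight source) + rank source + (width t k + window k (centre t k) t) ∎
  }
  where
  open ≡-Reasoning
  open ExtremalEdge (extremal t d)
  k = d + t
  a = ⌊ suc d /2⌋
  ws : ⟦ b ⟧ + weight source ≡ a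
  ws = trans (cong (⟦ b ⟧ +_) weight-source) b-eq
  wt : ⟦ b ⟧ + weight target ≡ a + t
  wt = begin
    ⟦ b ⟧ + weight target              ≡⟨ cong (⟦ b ⟧ +_) weight-target ⟩
    ⟦ b ⟧ + (⌊ d /2⌋ + k ⊓ t)          ≡⟨ +-assoc ⟦ b ⟧ _ _ ⟨
    ⟦ b ⟧ + ⌊ d /2⌋ + k ⊓ t            ≡⟨ cong₂ _+_ b-eq (m≥n⇒m⊓n≡n (m≤n+m t d)) ⟩
    a + t                              ∎
  eq : ∀ a b c d → a + b + (c + d) ≡ a + c + (d + b)
  eq = solve-∀

-- Harper's vertex-isoperimetric theorem

flip : Fin n → Vec Bool n → Vec Bool n
flip zero    (b ∷ x) = not b ∷ x
flip (suc i) (b ∷ x) = b ∷ flip i x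

flip-involutive : ∀ i (x : Vec Bool n) → flip i (flip i x) ≡ x
flip-involutive zero    (false ∷ x) = refl
flip-involutive zero    (true ∷ x)  = refl
flip-involutive (suc i) (b ∷ x)     = cong (b ∷_) (flip-involutive i x)

hamming-flip : ∀ i (u v : Vec Bool n) → hamming u (flip i v) ≤ suc (hamming u v)
hamming-flip zero (false ∷ u) (false ∷ v) = ≤-refl
hamming-flip zero (false ∷ u) (true ∷ v)  = m≤n+m _ 2
hamming-flip zero (true ∷ u)  (false ∷ v) = m≤n+m _ 2
hamming-flip zero (true ∷ u)  (true ∷ v)  = ≤-refl
hamming-flip (suc i) (false ∷ u) (false ∷ v) = hamming-flip i u v
hamming-flip (suc i) (false ∷ u) (true ∷ v)  = s≤s (hamming-flip i u v)
hamming-flip (suc i) (true ∷ u)  (false ∷ v) = s≤s (hamming-flip i u v)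
hamming-flip (suc i) (true ∷ u)  (true ∷ v)  = hamming-flip i u v

hamming≤0⇒≡ : (u v : Vec Bool n) → hamming u v ≤ 0 → u ≡ v
hamming≤0⇒≡ [] [] _ = refl
hamming≤0⇒≡ (false ∷ u) (false ∷ v) h = cong (false ∷_) (hamming≤0⇒≡ u v h)
hamming≤0⇒≡ (true ∷ u)  (true ∷ v)  h = cong (true ∷_) (hamming≤0⇒≡ u v h)

hamming-refl : (u : Vec Bool n) → hamming u u ≡ 0
hamming-refl []      = refl
hamming-refl (b ∷ u) = trans (hamming-∷-same b u u) (hamming-refl u)

hamming-step : ∀ {t} (u v : Vec Bool n) → hamming u v ≤ suc t →
               hamming u v ≤ t ⊎ ∃[ i ] hamming u (flip i v) ≤ t
hamming-step []          []          _       = inj₁ z≤n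
hamming-step (false ∷ u) (true ∷ v)  (s≤s h) = inj₂ (zero , h)
hamming-step (true ∷ u)  (false ∷ v) (s≤s h) = inj₂ (zero , h)
hamming-step (false ∷ u) (false ∷ v) h with hamming-step u v h
... | inj₁ h′       = inj₁ h′
... | inj₂ (i , h′) = inj₂ (suc i , h′)
hamming-step (true ∷ u)  (true ∷ v)  h with hamming-step u v h
... | inj₁ h′       = inj₁ h′
... | inj₂ (i , h′) = inj₂ (suc i , h′)

-- The closed neighbourhood in the hypercube, H(1,2,n).
N : Family n → Family n
N S []      = S []
N S (b ∷ x) = N (S ∘ (b ∷_)) x ∨ S (not b ∷ x)

∨-introˡ : ∀ {a b} → T a → T (a ∨ b)
∨-introˡ = Equivalence.from T-∨ ∘ inj₁

∨-introʳ : ∀ {a b} → T b → T (a ∨ b)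
∨-introʳ {a} = Equivalence.from (T-∨ {a}) ∘ inj₂

∨-elim : ∀ {a b} → T (a ∨ b) → T a ⊎ T b
∨-elim = Equivalence.to T-∨

N-self : {S : Family n} → ∀ x → T (S x) → T (N S x)
N-self []      x∈S = x∈S
N-self (b ∷ x) x∈S = ∨-introˡ (N-self x x∈S)

N-flip : {S : Family n} → ∀ i x → T (S (flip i x)) → T (N S x)
N-flip         zero    (b ∷ x) h = ∨-introʳ h
N-flip {S = S} (suc i) (b ∷ x) h = ∨-introˡ (N-flip {S = S ∘ (b ∷_)} i x h)

N-elim : {S : Family n} → ∀ x → T (N S x) → T (S x) ⊎ ∃[ i ] T (S (flip i x))
N-elim []      h = inj₁ h
N-elim {S = S} (b ∷ x) h with ∨-elim {N (S ∘ (b ∷_)) x} h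
... | inj₂ h₂ = inj₂ (zero , h₂)
... | inj₁ h₁ with N-elim {S = S ∘ (b ∷_)} x h₁
...   | inj₁ x∈S      = inj₁ x∈S
...   | inj₂ (i , h₃) = inj₂ (suc i , h₃)

N-mono : {S S′ : Family n} → (∀ x → T (S x) → T (S′ x)) → ∀ x → T (N S x) → T (N S′ x)
N-mono {S = S} S⊆S′ x h with N-elim {S = S} x h
... | inj₁ x∈S      = N-self x (S⊆S′ x x∈S)
... | inj₂ (i , h′) = N-flip i x (S⊆S′ _ h′)

-- The recursion of `N` along coordinate `i` in place of the first one; it describes `N` on the two
-- halves that a compression rearranges.
N-insertAt : (S : Family (suc n)) → ∀ i b x →
             N S (insertAt x i b) ≡ N (λ z → S (insertAt z i b)) x ∨ S (insertAt x i (not b))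
N-insertAt S zero    b x       = refl
N-insertAt S (suc i) b (c ∷ x) = begin
  N (S ∘ (c ∷_)) (insertAt x i b) ∨ r     ≡⟨ cong (_∨ r) (N-insertAt (S ∘ (c ∷_)) i b x) ⟩
  (p ∨ q) ∨ r                             ≡⟨ ∨-assoc p q r ⟩
  p ∨ (q ∨ r)                             ≡⟨ cong (p ∨_) (∨-comm q r) ⟩
  p ∨ (r ∨ q)                             ≡⟨ ∨-assoc p r q ⟨
  (p ∨ r) ∨ q                             ∎
  where
  open ≡-Reasoning
  p = N (λ z → S (c ∷ insertAt z i b)) x
  q = S (c ∷ insertAt x i (not b))
  r = S (not c ∷ insertAt x i b)

DownClosed : Family n → Set
DownClosed S = ∀ x y → rank x ≤ rank y → T (S y) → T (S x)

below-downClosed : ∀ m → DownClosed {n} (below m)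
below-downClosed m x y h y∈ = <⇒<ᵇ (≤-<-trans h (<ᵇ⇒< (rank y) m y∈))

weight≡0⇒rank≡0 : (x : Vec Bool n) → weight x ≡ 0 → rank x ≡ 0
weight≡0⇒rank≡0 [] _ = refl
weight≡0⇒rank≡0 {suc n} (false ∷ x) eq rewrite eq = weight≡0⇒rank≡0 x eq

data Zero∨Member (x : Vec Bool n) : Set where
  zeros  : weight x ≡ 0 → Zero∨Member x
  member : ∀ i → lookup x i ≡ true → Zero∨Member x

zero∨member : (x : Vec Bool n) → Zero∨Member x
zero∨member []          = zeros refl
zero∨member (true ∷ x)  = member zero refl
zero∨member (false ∷ x) with zero∨member x
... | zeros eq    = zeros eq
... | member i eq = member (suc i) eq

weight-flip-true : ∀ i (x : Vec Bool n) → lookup x i ≡ true → weight x ≡ suc (weight (flip i x))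
weight-flip-true zero    (true ∷ x) refl = refl
weight-flip-true (suc i) (b ∷ x)    eq   =
  trans (cong (⟦ b ⟧ +_) (weight-flip-true i x eq)) (+-suc ⟦ b ⟧ _)

weight-flip-false : ∀ i (x : Vec Bool n) → lookup x i ≡ false → weight (flip i x) ≡ suc (weight x)
weight-flip-false zero    (false ∷ x) refl = refl
weight-flip-false (suc i) (b ∷ x)     eq   =
  trans (cong (⟦ b ⟧ +_) (weight-flip-false i x eq)) (+-suc ⟦ b ⟧ _)

rank-flip-true : ∀ i (x : Vec Bool n) → lookup x i ≡ true → rank (flip i x) < rank x
rank-flip-true i x eq = weight-<⇒rank-< {x = flip i x} {x} (≤-reflexive (sym (weight-flip-true i x eq)))

-- Points are read as sets, with `true` marking members. Whichever member the later set loses, the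
-- earlier set can lose one without overtaking it. Where only the earlier set keeps the first
-- element, its result has the lighter tail and so comes first.
removal : ∀ (x y : Vec Bool n) i → weight x ≡ weight y → rank x < rank y → lookup y i ≡ true →
          ∃[ j ] (lookup x j ≡ true × rank (flip j x) ≤ rank (flip i y))
removal (false ∷ x) (true ∷ y) i w≡ x<y _ = contradiction
  (rank-≤⇒weight-≤ {x = x} {y} (<⇒≤ (tail-rank-< (false ∷ x) (true ∷ y) w≡ x<y))) (<⇒≱ (≤-reflexive (sym w≡)))
removal (true ∷ x) (true ∷ y) zero w≡ x<y _ with zero∨member x
... | zeros x≡0 = contradiction
  (trans (weight≡0⇒rank≡0 x x≡0) (sym (weight≡0⇒rank≡0 y (trans (sym (suc-injective w≡)) x≡0))))
  (<⇒≢ (tail-rank-< (true ∷ x) (true ∷ y) w≡ x<y))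
... | member j xj = suc j , xj , <⇒≤ (rank-tail-< (true ∷ flip j x) (false ∷ y) w-eq
  (weight-<⇒rank-< {x = flip j x} {y} (≤-reflexive w-eq)))
  where
  w-eq : suc (weight (flip j x)) ≡ weight y
  w-eq = trans (sym (weight-flip-true j x xj)) (suc-injective w≡)
removal (false ∷ x) (false ∷ y) (suc i) w≡ x<y yi
  with j , xj , h ← removal x y i w≡ (tail-rank-< (false ∷ x) (false ∷ y) w≡ x<y) yi
  = suc j , xj , rank-tail-≤ (false ∷ flip j x) (false ∷ flip i y)
      (suc-injective (trans (sym (weight-flip-true j x xj)) (trans w≡ (weight-flip-true i y yi)))) h
removal (true ∷ x) (true ∷ y) (suc i) w≡ x<y yi
  with j , xj , h ← removal x y i (suc-injective w≡) (tail-rank-< (true ∷ x) (true ∷ y) w≡ x<y) yi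
  = suc j , xj , rank-tail-≤ (true ∷ flip j x) (true ∷ flip i y)
      (trans (sym (weight-flip-true j x xj)) (trans (suc-injective w≡) (weight-flip-true i y yi))) h
removal (true ∷ x) (false ∷ y) (suc i) w≡ x<y yi with zero∨member x
... | member j xj = suc j , xj , <⇒≤ (rank-tail-< (true ∷ flip j x) (false ∷ flip i y) w-eq
  (weight-<⇒rank-< {x = flip j x} {flip i y} (≤-reflexive w-eq)))
  where
  w-eq : suc (weight (flip j x)) ≡ weight (flip i y)
  w-eq = trans (sym (weight-flip-true j x xj)) (suc-injective (trans w≡ (weight-flip-true i y yi)))
... | zeros x≡0 = zero , refl , ≤-reflexive (trans
  (weight≡0⇒rank≡0 (false ∷ x) x≡0)
  (sym (weight≡0⇒rank≡0 (false ∷ flip i y) (trans (suc-injective (trans (sym (weight-flip-true i y yi)) (sym w≡))) x≡0))))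

lookup-flip : ∀ i (x : Vec Bool n) → lookup (flip i x) i ≡ not (lookup x i)
lookup-flip zero    (b ∷ x) = refl
lookup-flip (suc i) (b ∷ x) = lookup-flip i x

true∨false : ∀ b → b ≡ true ⊎ b ≡ false
true∨false true  = inj₁ refl
true∨false false = inj₂ refl

-- Let `flip i y` lie in `S`. If the flip adds a member, `y` precedes `flip i y`, and so does `x`.
-- If it removes one, some removal from `x` comes no later than `flip i y`: by `removal` for
-- distinct points of equal weight, and by weight alone if `x` is lighter, unless `x` is empty and
-- thus first of all.
N-downClosed : {S : Family n} → DownClosed S → DownClosed (N S)
N-downClosed {S = S} closed x y x≤y y∈N with N-elim {S = S} y y∈N
... | inj₁ y∈S = N-self x (closed x y x≤y y∈S)
... | inj₂ (i , s∈S) with true∨false (lookup y i)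
...   | inj₂ yi = N-self x (closed x (flip i y) (≤-trans x≤y (<⇒≤ y<s)) s∈S)
  where
  y<s : rank y < rank (flip i y)
  y<s = weight-<⇒rank-< {x = y} {flip i y} (≤-reflexive (sym (weight-flip-false i y yi)))
...   | inj₁ yi with m≤n⇒m<n∨m≡n x≤y
...     | inj₂ x≡y = N-flip i x (subst (λ z → T (S (flip i z))) (sym (rank-injective x≡y)) s∈S)
...     | inj₁ x<y with m≤n⇒m<n∨m≡n (rank-≤⇒weight-≤ {x = x} {y} x≤y)
...       | inj₂ w≡ with j , _ , h ← removal x y i w≡ x<y yi = N-flip j x (closed _ _ h s∈S)
...       | inj₁ w< with zero∨member x
...         | zeros x≡0 = N-self x (closed x _ (≤-trans (≤-reflexive (weight≡0⇒rank≡0 x x≡0)) z≤n) s∈S)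
...         | member j xj = N-flip j x (closed (flip j x) (flip i y)
  (<⇒≤ (weight-<⇒rank-< {x = flip j x} {flip i y} (begin
    suc (weight (flip j x)) ≡⟨ weight-flip-true j x xj ⟨
    weight x                ≤⟨ s≤s⁻¹ (≤-trans w< (≤-reflexive (weight-flip-true i y yi))) ⟩
    weight (flip i y)       ∎))) s∈S)
  where open ≤-Reasoning

-- Down-closed families are nested, so the union is one of the two.
card-∪-downClosed : {P Q : Family n} → DownClosed P → DownClosed Q →
                    card (λ x → P x ∨ Q x) ≤ card P ⊔ card Q
card-∪-downClosed {P = P} {Q} closedP closedQ with anyVec? (λ x → T? (P x) ×-dec ¬? (T? (Q x)))
... | yes (x , x∈P , x∉Q) = ≤-trans (card-mono (λ z → [ id , Q⊆P z ]′ ∘ ∨-elim {P z})) (m≤m⊔n _ _)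
  where
  Q⊆P : ∀ z → T (Q z) → T (P z)
  Q⊆P z z∈Q = closedP z x (≮⇒≥ λ x<z → x∉Q (closedQ x z (<⇒≤ x<z) z∈Q)) x∈P
... | no P⊆Q = ≤-trans (card-mono (λ z → [ P⊆Q′ z , id ]′ ∘ ∨-elim {P z})) (m≤n⊔m (card P) _)
  where
  P⊆Q′ : ∀ z → T (P z) → T (Q z)
  P⊆Q′ z z∈P = decidable-stable (T? (Q z)) λ z∉Q → P⊆Q (z , z∈P , z∉Q)

-- Compression along a coordinate

weight-insertAt : ∀ (x : Vec Bool n) i b → weight (insertAt x i b) ≡ ⟦ b ⟧ + weight x
weight-insertAt x       zero    b = refl
weight-insertAt (c ∷ x) (suc i) b = trans (cong (⟦ c ⟧ +_) (weight-insertAt x i b)) (eq ⟦ c ⟧ ⟦ b ⟧ (weight x))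
  where
  eq : ∀ a b c → a + (b + c) ≡ b + (a + c)
  eq = solve-∀

-- The inserted bit changes the weights of corresponding suffixes equally, so each half of the cube
-- inherits the simplicial order.
rank-insertAt-< : ∀ (x y : Vec Bool n) i b → rank x < rank y → rank (insertAt x i b) < rank (insertAt y i b)
rank-insertAt-< x y i b x<y with m≤n⇒m<n∨m≡n (rank-≤⇒weight-≤ {x = x} {y} (<⇒≤ x<y))
... | inj₁ w< = weight-<⇒rank-< {x = insertAt x i b} {insertAt y i b}
  (subst₂ _<_ (sym (weight-insertAt x i b)) (sym (weight-insertAt y i b)) (+-monoʳ-< ⟦ b ⟧ w<))
rank-insertAt-< x y zero b x<y | inj₂ w≡ = rank-tail-< (b ∷ x) (b ∷ y) (cong (⟦ b ⟧ +_) w≡) x<y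
rank-insertAt-< (c ∷ x) (d ∷ y) (suc i) b x<y | inj₂ w≡ =
  rank-tail-< (c ∷ insertAt x i b) (d ∷ insertAt y i b)
    (trans (weight-insertAt (c ∷ x) (suc i) b)
      (trans (cong (⟦ b ⟧ +_) w≡) (sym (weight-insertAt (d ∷ y) (suc i) b))))
    (rank-insertAt-< x y i b (tail-rank-< (c ∷ x) (d ∷ y) w≡ x<y))

rank-insertAt-cancel-< : ∀ (x y : Vec Bool n) i b → rank (insertAt x i b) < rank (insertAt y i b) → rank x < rank y
rank-insertAt-cancel-< x y i b h with <-cmp (rank x) (rank y)
... | tri< x<y _ _ = x<y
... | tri≈ _ x≡y _ = contradiction (cong (λ z → rank (insertAt z i b)) (rank-injective x≡y)) (<⇒≢ h)
... | tri> _ _ y<x = contradiction (rank-insertAt-< y x i b y<x) (<-asym h)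

-- This is `(⟦ a ⟧ - ⟦ s ⟧) * (f - θ) ≤ 0` with the subtractions moved across.
exchange-≤ : ∀ a s {f θ} → (T a → f ≤ θ) → (¬ T a → θ ≤ f) → ⟦ a ⟧ * f + ⟦ s ⟧ * θ ≤ ⟦ s ⟧ * f + ⟦ a ⟧ * θ
exchange-≤ false false         _   _   = ≤-refl
exchange-≤ true  true          _   _   = ≤-refl
exchange-≤ true  false {f} {θ} f≤θ _   rewrite +-identityʳ f | +-identityʳ f | +-identityʳ θ = f≤θ _
exchange-≤ false true  {f} {θ} _   θ≤f rewrite +-identityʳ f | +-identityʳ f | +-identityʳ θ = θ≤f id

exchange-<ˡ : ∀ a s {f θ} → T a → ¬ T s → f < θ → ⟦ a ⟧ * f + ⟦ s ⟧ * θ < ⟦ s ⟧ * f + ⟦ a ⟧ * θ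
exchange-<ˡ true  false {f} {θ} _ _  f<θ rewrite +-identityʳ f | +-identityʳ f | +-identityʳ θ = f<θ
exchange-<ˡ _     true          _ ¬s _ = contradiction _ ¬s

exchange-<ʳ : ∀ a s {f θ} → ¬ T a → T s → θ < f → ⟦ a ⟧ * f + ⟦ s ⟧ * θ < ⟦ s ⟧ * f + ⟦ a ⟧ * θ
exchange-<ʳ false true  {f} {θ} _  _ θ<f rewrite +-identityʳ f | +-identityʳ f | +-identityʳ θ = θ<f
exchange-<ʳ true  _             ¬a _ _ = contradiction _ ¬a

-- Among families of a given size the initial segment minimises the total of an increasing `f`,
-- strictly so against a family that omits an earlier point and contains a later one.
module Rearrangement (f : Vec Bool n → ℕ) (f-mono : ∀ x y → rank x < rank y → f x < f y) (S : Family n) where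

  private
    total-of : Family n → ℕ
    total-of S = total (λ x → ⟦ S x ⟧ * f x)

    f-mono-≤ : ∀ x y → rank x ≤ rank y → f x ≤ f y
    f-mono-≤ x y h with m≤n⇒m<n∨m≡n h
    ... | inj₁ x<y = <⇒≤ (f-mono x y x<y)
    ... | inj₂ x≡y = ≤-reflexive (cong f (rank-injective x≡y))

    module Threshold (c : ℕ) (cardS : card S ≡ suc c) where

      I : Family n
      I = below (suc c)

      c<2^n : c < 2 ^ n
      c<2^n = ≤-trans (≤-reflexive (sym cardS)) (card≤2^n S)

      last : Vec Bool n
      last = proj₁ (Rank.surjective {n} c<2^n)

      rank-last : rank last ≡ c
      rank-last = proj₂ (Rank.surjective {n} c<2^n)

      -- Separates the values of f inside the segment from those outside it, so that
      -- exchanging an outside point for an inside one cannot increase the total.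
      θ = f last

      inside : ∀ x → T (I x) → f x ≤ θ
      inside x x∈I = f-mono-≤ x last (≤-trans (s≤s⁻¹ (<ᵇ⇒< (rank x) _ x∈I)) (≤-reflexive (sym rank-last)))

      outside : ∀ x → ¬ T (I x) → θ < f x
      outside x x∉I = f-mono last x (≤-trans (≤-reflexive (cong suc rank-last)) (≮⇒≥ (x∉I ∘ <⇒<ᵇ)))

      left right : Vec Bool n → ℕ
      left  x = ⟦ I x ⟧ * f x + ⟦ S x ⟧ * θ
      right x = ⟦ S x ⟧ * f x + ⟦ I x ⟧ * θ

      left≤right : ∀ x → left x ≤ right x
      left≤right x = exchange-≤ (I x) (S x) (inside x) (<⇒≤ ∘ outside x)

      total-left : total left ≡ total-of I + suc c * θ
      total-left = trans (total-+ (λ x → ⟦ I x ⟧ * f x) _)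
        (cong (total-of I +_) (trans (total-*ʳ (⟦_⟧ ∘ S) θ) (cong (_* θ) cardS)))

      total-right : total right ≡ total-of S + suc c * θ
      total-right = trans (total-+ (λ x → ⟦ S x ⟧ * f x) _)
        (cong (total-of S +_) (trans (total-*ʳ (⟦_⟧ ∘ I) θ) (cong (_* θ) (card-below {n} c<2^n))))

      total-≤ : total-of I ≤ total-of S
      total-≤ = +-cancelʳ-≤ (suc c * θ) _ _ (subst₂ _≤_ total-left total-right (total-mono left≤right))

      total-< : ∀ x → left x < right x → total-of I < total-of S
      total-< x h = +-cancelʳ-< (suc c * θ) _ _ (subst₂ _<_ total-left total-right (total-mono-< left≤right x h))

  segment-≤ : total-of (below (card S)) ≤ total-of S
  segment-≤ with card S in eq
  ... | suc c = Threshold.total-≤ c eq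
  ... | zero  = total-mono {g = λ x → ⟦ S x ⟧ * f x} λ _ → z≤n

  -- The strict term comes from `y` if `y` lies outside the segment. Otherwise it comes from `x`,
  -- which then lies in the segment but not in `S` and has a value below that of `y`.
  segment-< : ∀ x y → rank x < rank y → ¬ T (S x) → T (S y) → total-of (below (card S)) < total-of S
  segment-< x y x<y x∉S y∈S with card S in eq
  ... | zero  = contradiction eq (m<n⇒n≢0 (card-mono-< {S = λ _ → false} (λ _ ()) y id y∈S))
  ... | suc c with T? (below (suc c) y)
  ...   | yes y∈I = Threshold.total-< c eq x (exchange-<ˡ (below (suc c) x) (S x)
    (below-downClosed (suc c) x y (<⇒≤ x<y) y∈I) x∉S
    (<-≤-trans (f-mono x y x<y) (Threshold.inside c eq y y∈I)))
  ...   | no y∉I = Threshold.total-< c eq y (exchange-<ʳ (below (suc c) y) (S y) y∉I y∈S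
    (Threshold.outside c eq y y∉I))

section : Fin (suc n) → Bool → Family (suc n) → Family n
section i b S x = S (insertAt x i b)

compress : Fin (suc n) → Family (suc n) → Family (suc n)
compress i S x = below (card (section i (lookup x i) S)) (removeAt x i)

section-compress : ∀ (S : Family (suc n)) i b x →
                   section i b (compress i S) x ≡ below (card (section i b S)) x
section-compress S i b x =
  cong₂ (λ c z → below (card (section i c S)) z) (insertAt-lookup x i b) (removeAt-insertAt x i b)

card-compress : (S : Family (suc n)) → ∀ i → card (compress i S) ≡ card S
card-compress {n} S i = begin
  card (compress i S)                                                      ≡⟨ total-insertAt (⟦_⟧ ∘ compress i S) i ⟩
  card (section i false (compress i S)) + card (section i true (compress i S)) ≡⟨ cong₂ _+_ (part false) (part true) ⟩
  card (section i false S) + card (section i true S)                       ≡⟨ total-insertAt (⟦_⟧ ∘ S) i ⟨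
  card S                                                                   ∎
  where
  open ≡-Reasoning
  part : ∀ b → card (section i b (compress i S)) ≡ card (section i b S)
  part b = trans (total-cong (cong ⟦_⟧ ∘ section-compress S i b)) (card-below {n} (card≤2^n (section i b S)))

-- The measure that makes repeated compression terminate.
potential : Family n → ℕ
potential S = total (λ x → ⟦ S x ⟧ * rank x)

Bad : Family n → Vec Bool n → Vec Bool n → Set
Bad S x y = rank x < rank y × ¬ T (S x) × T (S y)

bad? : (S : Family n) → ∀ x y → Dec (Bad S x y)
bad? S x y = rank x <? rank y ×-dec ¬? (T? (S x)) ×-dec T? (S y)

-- A bad pair that agrees at `i` lies within one half, whose rank sum drops strictly; that of the
-- other half does not increase.
potential-compress : ∀ (S : Family (suc n)) i {x y} → Bad S x y → lookup x i ≡ lookup y i →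
                     potential (compress i S) < potential S
potential-compress S i {x} {y} (x<y , x∉S , y∈S) xi≡yi = begin-strict
  potential (compress i S)            ≡⟨ total-insertAt (λ x → ⟦ compress i S x ⟧ * rank x) i ⟩
  part compressed false + part compressed true ≡⟨ cong₂ _+_ (part-compressed false) (part-compressed true) ⟩
  part segment false + part segment true       <⟨ part-< ⟩
  part (λ b → section i b S) false + part (λ b → section i b S) true ≡⟨ total-insertAt (λ x → ⟦ S x ⟧ * rank x) i ⟨
  potential S                         ∎
  where
  open ≤-Reasoning
  part : (Bool → Family _) → Bool → ℕ
  part F b = total λ x → ⟦ F b x ⟧ * rank (insertAt x i b)
  compressed segment : Bool → Family _
  compressed b = section i b (compress i S)
  segment b    = below (card (section i b S))
  part-compressed : ∀ b → part compressed b ≡ part segment b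
  part-compressed b = total-cong λ x → cong (λ c → ⟦ c ⟧ * rank (insertAt x i b)) (section-compress S i b x)
  module R b = Rearrangement (λ x → rank (insertAt x i b)) (λ x y → rank-insertAt-< x y i b) (section i b S)
  b = lookup x i
  x≡ : insertAt (removeAt x i) i b ≡ x
  x≡ = insertAt-removeAt x i
  y≡ : insertAt (removeAt y i) i b ≡ y
  y≡ = trans (cong (insertAt (removeAt y i) i) xi≡yi) (insertAt-removeAt y i)
  own-part-< : part segment b < part (λ b → section i b S) b
  own-part-< = R.segment-< b (removeAt x i) (removeAt y i)
    (rank-insertAt-cancel-< (removeAt x i) (removeAt y i) i b
      (subst₂ (λ u v → rank u < rank v) (sym x≡) (sym y≡) x<y))
    (x∉S ∘ subst (T ∘ S) x≡) (subst (T ∘ S) (sym y≡) y∈S)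
  part-< : part segment false + part segment true <
           part (λ b → section i b S) false + part (λ b → section i b S) true
  part-< with lookup x i | own-part-<
  ... | false | h = +-mono-<-≤ h (R.segment-≤ true)
  ... | true  | h = +-mono-≤-< (R.segment-≤ false) h

-- Families whose bad pairs are complementary

weight-complement : (x : Vec Bool n) → weight x + weight (map not x) ≡ n
weight-complement []          = refl
weight-complement (false ∷ x) = trans (+-suc (weight x) _) (cong suc (weight-complement x))
weight-complement (true ∷ x)  = cong suc (weight-complement x)

rank-≤-ones : (x z : Vec Bool n) → weight x ≡ 0 → rank z ≤ rank (map not x)
rank-≤-ones []          []      _   = z≤n
rank-≤-ones {suc n} (false ∷ x) (c ∷ z) x≡0 = +-mono-≤
  (ballSize-mono n (≤-trans (weight≤n (c ∷ z)) (≤-reflexive (cong suc (sym (trans (cong (_+ weight (map not x)) (sym x≡0)) (weight-complement x)))))))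
  (rank-≤-ones x z x≡0)

lookup-flip-other : ∀ {i j} (x : Vec Bool n) → lookup x i ≢ lookup x j → lookup (flip i x) j ≡ lookup x j
lookup-flip-other {i = zero}  {zero}  (b ∷ x) i≢j = contradiction refl i≢j
lookup-flip-other {i = zero}  {suc j} (b ∷ x) i≢j = refl
lookup-flip-other {i = suc i} {zero}  (b ∷ x) i≢j = refl
lookup-flip-other {i = suc i} {suc j} (b ∷ x) i≢j = lookup-flip-other x i≢j

true≢false : ∀ {b c} → b ≡ true → c ≡ false → b ≢ c
true≢false refl refl ()

weight-swap : ∀ i j (x : Vec Bool n) → lookup x i ≡ false → lookup x j ≡ true → weight (flip j (flip i x)) ≡ weight x
weight-swap i j x xi xj = suc-injective (trans
  (sym (weight-flip-true j (flip i x) (trans (lookup-flip-other x (true≢false xj xi ∘ sym)) xj)))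
  (weight-flip-false i x xi))

flip-≢ : ∀ i (x : Vec Bool n) → flip i x ≢ x
flip-≢ zero    (false ∷ x) ()
flip-≢ zero    (true ∷ x)  ()
flip-≢ (suc i) (b ∷ x)     eq = flip-≢ i x (cong tail eq)

swap-≢ : ∀ i j (x : Vec Bool n) → lookup x i ≡ false → lookup x j ≡ true → flip j (flip i x) ≢ x
swap-≢ i j x xi xj eq = contradiction (trans (sym (weight-flip-false i x xi)) (trans
  (cong weight (trans (sym (flip-involutive j (flip i x))) (cong (flip j) eq)))
  refl)) (λ h → <⇒≢ (≤-trans (≤-reflexive (sym (weight-flip-true j x xj))) (n≤1+n _)) (sym h))

-- Since `x` precedes its complement at equal weight, its first bit is true. If the tail has a
-- member `j`, trading it for `i` keeps this bit, so the tail remains lighter than that of the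
-- complement. Otherwise the first element is traded, and the tail of the complement is all ones.
exchange-neighbour : ∀ i (x : Vec Bool (suc n)) → weight x ≡ weight (map not x) → rank x < rank (map not x) →
  lookup x i ≡ false → ∃[ j ] (flip j (flip i x) ≢ x × rank (flip j (flip i x)) ≤ rank (map not x))
exchange-neighbour i (false ∷ x) w≡ x<x̄ _ = contradiction
  (rank-≤⇒weight-≤ {x = x} {map not x} (<⇒≤ (tail-rank-< (false ∷ x) (true ∷ map not x) w≡ x<x̄)))
  (<⇒≱ (≤-reflexive (sym w≡)))
exchange-neighbour (suc i) (true ∷ x) w≡ x<x̄ xi with zero∨member x
... | member j xj =
  suc j , swap-≢ i j x xi xj ∘ cong tail ,
  <⇒≤ (rank-tail-< (true ∷ z) (false ∷ map not x) (trans (cong suc wz) w≡)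
        (weight-<⇒rank-< {x = z} {map not x} (≤-reflexive (trans (cong suc wz) w≡))))
  where
  z  = flip j (flip i x)
  wz = weight-swap i j x xi xj
... | zeros x≡0 =
  zero , (λ ()) ,
  rank-tail-≤ (false ∷ flip i x) (false ∷ map not x) (trans (weight-flip-false i x xi) w≡) (rank-≤-ones x (flip i x) x≡0)

-- The initial segment may contain `x` although `S` does not. The other points up to the complement
-- of `x` suffice to put `x` and all its neighbours into `N S`.
module Covered (S : Family (suc n)) (x : Vec Bool (suc n)) (x<x̄ : rank x < rank (map not x))
               (S-upto : ∀ z → z ≢ x → rank z ≤ rank (map not x) → T (S z)) where

  private
    removed : ∀ i → lookup x i ≡ true → T (S (flip i x))
    removed i xi = S-upto (flip i x) (flip-≢ i x) (<⇒≤ (<-trans (rank-flip-true i x xi) x<x̄))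

  self : T (N S x)
  self with zero∨member x
  ... | member j xj = N-flip j x (removed j xj)
  ... | zeros x≡0   = N-flip zero x (S-upto (flip zero x) (flip-≢ zero x) (rank-≤-ones x (flip zero x) x≡0))

  neighbour : ∀ i → T (N S (flip i x))
  neighbour i with true∨false (lookup x i)
  ... | inj₁ xi = N-self (flip i x) (removed i xi)
  ... | inj₂ xi with m≤n⇒m<n∨m≡n (rank-≤⇒weight-≤ {x = x} {map not x} (<⇒≤ x<x̄))
  ...   | inj₂ w≡ with j , z≢x , z≤x̄ ← exchange-neighbour i x w≡ x<x̄ xi =
    N-flip j (flip i x) (S-upto _ z≢x z≤x̄)
  ...   | inj₁ w< with zero∨member x
  ...     | zeros x≡0   = N-self (flip i x) (S-upto (flip i x) (flip-≢ i x) (rank-≤-ones x (flip i x) x≡0))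
  ...     | member j xj = N-flip j (flip i x) (S-upto z (swap-≢ i j x xi xj)
    (<⇒≤ (weight-<⇒rank-< {x = z} {map not x} (≤-trans (≤-reflexive (cong suc (weight-swap i j x xi xj))) w<))))
    where
    z = flip j (flip i x)

complement-≡ : (x y : Vec Bool n) → (∀ i → lookup x i ≢ lookup y i) → y ≡ map not x
complement-≡ []          []          _  = refl
complement-≡ (false ∷ x) (false ∷ y) x≢ = contradiction refl (x≢ zero)
complement-≡ (true ∷ x)  (true ∷ y)  x≢ = contradiction refl (x≢ zero)
complement-≡ (false ∷ x) (true ∷ y)  x≢ = cong (true ∷_) (complement-≡ x y (x≢ ∘ suc))
complement-≡ (true ∷ x)  (false ∷ y) x≢ = cong (false ∷_) (complement-≡ x y (x≢ ∘ suc))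

map-not-injective : (x y : Vec Bool n) → map not x ≡ map not y → x ≡ y
map-not-injective []          []          _  = refl
map-not-injective (false ∷ x) (false ∷ y) eq = cong (false ∷_) (map-not-injective x y (cong tail eq))
map-not-injective (true ∷ x)  (true ∷ y)  eq = cong (true ∷_) (map-not-injective x y (cong tail eq))

initial : Family n → Family n
initial S = below (card S)

initial-downClosed : (S : Family n) → DownClosed (initial S)
initial-downClosed S = below-downClosed (card S)

-- The families that compression cannot improve.  A remaining bad pair is x and its
-- complement, and then S is the segment before x together with the complement of x.
segment⊆N : (S : Family (suc n)) → (∀ {x y} → Bad S x y → ∀ i → lookup x i ≢ lookup y i) →
            ∀ w → T (N (initial S) w) → T (N S w)
segment⊆N {n} S bad⇒≢ with anyVec? (λ x → anyVec? (bad? S x))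
... | no ∄bad = N-mono segment⊆S
  where
  segment⊆S : ∀ z → T (initial S z) → T (S z)
  -- Without bad pairs, a missing `z` would come after all of `S`. Then `S` would have at most
  -- `rank z` points, too few for the segment to reach `z`.
  segment⊆S z z∈ = decidable-stable (T? (S z)) λ z∉S → <-irrefl refl (begin-strict
    card S                ≤⟨ card-mono (λ s s∈S → <⇒<ᵇ (before z∉S s s∈S)) ⟩
    card (below {suc n} (rank z)) ≤⟨ Rank.card-below-≤ {suc n} (rank z) ⟩
    rank z                <⟨ <ᵇ⇒< (rank z) _ z∈ ⟩
    card S                ∎)
    where
    open ≤-Reasoning
    before : ¬ T (S z) → ∀ s → T (S s) → rank s < rank z
    before z∉S s s∈S with <-cmp (rank s) (rank z)
    ... | tri< s<z _ _ = s<z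
    ... | tri≈ _ s≡z _ = contradiction (subst (T ∘ S) (rank-injective s≡z) s∈S) z∉S
    ... | tri> _ _ z<s′ = contradiction (z , s , z<s′ , z∉S , s∈S) ∄bad
... | yes (x , y , x<y , x∉S , y∈S) = segment⊆
  where
  y≡x̄ : y ≡ map not x
  y≡x̄ = complement-≡ x y (bad⇒≢ (x<y , x∉S , y∈S))

  S-upto : ∀ z → z ≢ x → rank z ≤ rank y → T (S z)
  S-upto z z≢x z≤y with m≤n⇒m<n∨m≡n z≤y
  ... | inj₂ z≡y = subst (T ∘ S) (sym (rank-injective z≡y)) y∈S
  -- A missing `z` would form a bad pair with `y` and so be the complement of `y`, which is `x`.
  ... | inj₁ z<y = decidable-stable (T? (S z)) λ z∉S → z≢x (map-not-injective z x
    (trans (sym (complement-≡ z y (bad⇒≢ (z<y , z∉S , y∈S)))) y≡x̄))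

  S-from : ∀ z → T (S z) → T (below (rank x) z) ⊎ z ≡ y
  S-from z z∈S with <-cmp (rank z) (rank x)
  ... | tri< z<x _ _ = inj₁ (<⇒<ᵇ z<x)
  ... | tri≈ _ z≡x _ = contradiction (subst (T ∘ S) (rank-injective z≡x) z∈S) x∉S
  ... | tri> _ _ x<z = inj₂ (trans (complement-≡ x z (bad⇒≢ (x<z , x∉S , z∈S))) (sym y≡x̄))

  predecessors only-y : Family (suc n)
  predecessors z = below (rank x) z
  only-y z       = rank z ≡ᵇ rank y

  -- Hence the segment ends at `x` or before, and `x` is the only point of it that `S` can lack.
  card-S : card S ≤ suc (rank x)
  card-S = begin
    card S                                          ≤⟨ total-mono split ⟩
    total (λ z → ⟦ predecessors z ⟧ + ⟦ only-y z ⟧) ≡⟨ total-+ (⟦_⟧ ∘ predecessors) (⟦_⟧ ∘ only-y) ⟩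
    card predecessors + card only-y                 ≤⟨ +-mono-≤ (Rank.card-below-≤ {suc n} (rank x)) (card-subsingleton {S = only-y} unique) ⟩
    rank x + 1                                      ≡⟨ +-comm (rank x) 1 ⟩
    suc (rank x)                                    ∎
    where
    open ≤-Reasoning
    unique : ∀ u v → T (only-y u) → T (only-y v) → u ≡ v
    unique u v p q = rank-injective (trans (≡ᵇ⇒≡ _ (rank y) p) (sym (≡ᵇ⇒≡ _ (rank y) q)))
    split : ∀ z → ⟦ S z ⟧ ≤ ⟦ predecessors z ⟧ + ⟦ only-y z ⟧
    split z with T? (S z)
    ... | no z∉S rewrite ¬T⇒⟦⟧≡0 z∉S = z≤n
    ... | yes z∈S rewrite T⇒⟦⟧≡1 z∈S with S-from z z∈S
    ...   | inj₁ z<x rewrite T⇒⟦⟧≡1 z<x = s≤s z≤n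
    ...   | inj₂ refl rewrite T⇒⟦⟧≡1 (≡⇒≡ᵇ (rank y) (rank y) refl) = m≤n+m 1 _

  module C = Covered S x (subst (λ z → rank x < rank z) y≡x̄ x<y)
                     (λ z z≢x h → S-upto z z≢x (subst (λ v → rank z ≤ rank v) (sym y≡x̄) h))

  segment-cases : ∀ z → T (initial S z) → z ≡ x ⊎ T (S z)
  segment-cases z z∈ with m≤n⇒m<n∨m≡n (s≤s⁻¹ (≤-trans (<ᵇ⇒< (rank z) _ z∈) card-S))
  ... | inj₂ z≡x = inj₁ (rank-injective z≡x)
  ... | inj₁ z<x = inj₂ (S-upto z (λ { refl → <-irrefl refl z<x }) (<⇒≤ (<-trans z<x x<y)))

  segment⊆ : ∀ w → T (N (initial S) w) → T (N S w)
  segment⊆ w w∈ with N-elim {S = initial S} w w∈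
  ... | inj₁ w∈I with segment-cases w w∈I
  ...   | inj₁ refl = C.self
  ...   | inj₂ w∈S  = N-self w w∈S
  segment⊆ w w∈ | inj₂ (i , z∈I) with segment-cases (flip i w) z∈I
  ...   | inj₁ z≡x  = subst (T ∘ N S) (trans (cong (flip i) (sym z≡x)) (flip-involutive i w)) (C.neighbour i)
  ...   | inj₂ z∈S  = N-flip i w z∈S

-- Within a half, `N S` is the union of the neighbourhood of its own section and the opposite
-- section. After compression both are down-closed, so their union is no larger than the larger one.
-- Each is bounded by its counterpart before compression, the neighbourhood by Harper's theorem one
-- dimension lower.
card-N-compress : (S : Family (suc n)) → (∀ (F : Family n) → card (N (initial F)) ≤ card (N F)) →
                  ∀ i → card (N (compress i S)) ≤ card (N S)
card-N-compress {n} S harper i = begin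
  card (N (compress i S))
    ≡⟨ total-insertAt (⟦_⟧ ∘ N (compress i S)) i ⟩
  card (section i false (N (compress i S))) + card (section i true (N (compress i S)))
    ≤⟨ +-mono-≤ (part false) (part true) ⟩
  card (section i false (N S)) + card (section i true (N S))
    ≡⟨ total-insertAt (⟦_⟧ ∘ N S) i ⟨
  card (N S) ∎
  where
  open ≤-Reasoning
  segment : Bool → Family _
  segment b = initial (section i b S)
  to-segment : ∀ b x → T (section i b (compress i S) x) → T (segment b x)
  to-segment b x = subst T (section-compress S i b x)
  part : ∀ b → card (section i b (N (compress i S))) ≤ card (section i b (N S))
  part b = begin
    card (section i b (N (compress i S)))
      ≤⟨ card-mono (λ x x∈ → [ ∨-introˡ ∘ N-mono (to-segment b) x , ∨-introʳ ∘ to-segment (not b) x ]′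
           (∨-elim {N (section i b (compress i S)) x} (subst T (N-insertAt (compress i S) i b x) x∈))) ⟩
    card (λ x → N (segment b) x ∨ segment (not b) x)
      ≤⟨ card-∪-downClosed (N-downClosed (initial-downClosed (section i b S))) (initial-downClosed (section i (not b) S)) ⟩
    card (N (segment b)) ⊔ card (segment (not b))
      ≤⟨ ⊔-mono-≤ (harper (section i b S)) (Rank.card-below-≤ {n} (card (section i (not b) S))) ⟩
    card (N (section i b S)) ⊔ card (section i (not b) S)
      ≤⟨ ⊔-lub (card-mono λ x x∈ → subst T (sym (N-insertAt S i b x)) (∨-introˡ x∈))
               (card-mono λ x x∈ → subst T (sym (N-insertAt S i b x)) (∨-introʳ x∈)) ⟩
    card (section i b (N S)) ∎

-- Induction on the dimension, compressing as long as some bad pair agrees in a coordinate. Each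
-- compression keeps the size and lowers the potential, which the fuel bounds.
harper : (S : Family n) → card (N (initial S)) ≤ card (N S)
harper {zero} S with S []
... | true  = ≤-refl
... | false = ≤-refl
harper {suc n} S = go (suc (potential S)) S ≤-refl
  where
  go : ∀ fuel (S : Family (suc n)) → potential S < fuel → card (N (initial S)) ≤ card (N S)
  go (suc fuel) S (s≤s p≤) with anyVec? (λ x → anyVec? (λ y → bad? S x y ×-dec Fin.any? (λ i → lookup x i ≟ᵇ lookup y i)))
  ... | yes (x , y , bad , i , xi≡yi) = begin
    card (N (initial S))              ≡⟨ cong (λ c → card (N (below {suc n} c))) (card-compress S i) ⟨
    card (N (initial (compress i S))) ≤⟨ go fuel (compress i S) (<-≤-trans (potential-compress S i bad xi≡yi) p≤) ⟩
    card (N (compress i S))                ≤⟨ card-N-compress S harper i ⟩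
    card (N S)                             ∎
    where open ≤-Reasoning
  ... | no ∄ = card-mono (segment⊆N S λ {x} {y} bad i xi≡yi → ∄ (x , y , bad , i , xi≡yi))

-- Iterated neighbourhoods

ball : ℕ → Family n → Family n
ball zero    S = S
ball (suc t) S = N (ball t S)

-- The initial segment of size `card S` contains `u`, so its neighbourhood contains `flip i u` and,
-- being down-closed, everything before it. Harper's theorem passes this count on to `N S`.
N-growth : ∀ (S : Family n) i (u : Vec Bool n) → rank u < card S → rank (flip i u) < card (N S)
N-growth {n} S i u u< = begin-strict
  rank (flip i u)                     <⟨ n<1+n _ ⟩
  suc (rank (flip i u))               ≡⟨ card-below {n} (rank<2^n (flip i u)) ⟨
  card (below {n} (suc (rank (flip i u)))) ≤⟨ card-mono (λ x x∈ → N-downClosed (initial-downClosed S) x (flip i u)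
     (s≤s⁻¹ (<ᵇ⇒< (rank x) _ x∈)) (N-flip i (flip i u) (subst (T ∘ initial S) (sym (flip-involutive i u)) (<⇒<ᵇ u<)))) ⟩
  card (N (initial S))           ≤⟨ harper S ⟩
  card (N S)                          ∎
  where open ≤-Reasoning

-- Walks from `u` to `v` with at most one flip per neighbourhood; only sizes are tracked, so
-- Harper's theorem applies afresh at each step.
ball-growth : ∀ t (S : Family n) (u v : Vec Bool n) → hamming u v ≤ t → rank u < card S → rank v < card (ball t S)
ball-growth zero    S u v h u< rewrite hamming≤0⇒≡ u v h = u<
ball-growth (suc t) S u v h u< with hamming-step u v h
... | inj₁ h′       = <-≤-trans (ball-growth t S u v h′ u<) (card-mono {S = ball t S} N-self)
... | inj₂ (i , h′) = subst (λ z → rank z < card (N (ball t S))) (flip-involutive i v)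
  (N-growth (ball t S) i (flip i v) (ball-growth t S u (flip i v) h′ u<))

ball-elim : ∀ t {S : Family n} v → T (ball t S v) → ∃[ u ] (T (S u) × hamming u v ≤ t)
ball-elim zero    v v∈ = v , v∈ , ≤-reflexive (hamming-refl v)
ball-elim (suc t) {S} v v∈ with N-elim {S = ball t S} v v∈
... | inj₁ v∈′ with u , u∈S , h ← ball-elim t v v∈′ = u , u∈S , m≤n⇒m≤1+n h
... | inj₂ (i , v∈′) with u , u∈S , h ← ball-elim t (flip i v) v∈′ =
  u , u∈S , ≤-trans (≤-trans (≤-reflexive (cong (hamming u) (sym (flip-involutive i v)))) (hamming-flip i u (flip i v))) (s≤s h)

-- Path decompositions

enum : Vec Bool n → Fin (2 ^ n)
enum {n} = Inverse.to (binaryVectors↔ n)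

members : ∀ n → Subset (2 ^ n) → Family n
members n X v = lookup X (enum v)

∈⇒members : (X : Subset (2 ^ n)) (v : Vec Bool n) → enum v ∈ X → T (members n X v)
∈⇒members X v v∈X = Equivalence.from T-≡ ([]=⇒lookup v∈X)

members⇒∈ : (X : Subset (2 ^ n)) (v : Vec Bool n) → T (members n X v) → enum v ∈ X
members⇒∈ X v v∈X = lookup⇒[]= (enum v) X (Equivalence.to T-≡ v∈X)

∣++∣ : ∀ {k l} (X : Subset k) (Y : Subset l) → ∣ X ++ Y ∣ ≡ ∣ X ∣ + ∣ Y ∣
∣++∣ []          Y = refl
∣++∣ (false ∷ X) Y = ∣++∣ X Y
∣++∣ (true ∷ X)  Y = cong suc (∣++∣ X Y)

card-members : ∀ n (X : Subset (2 ^ n)) → card (members n X) ≡ ∣ X ∣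
card-members zero    (false ∷ []) = refl
card-members zero    (true ∷ [])  = refl
card-members (suc n) X
  -- `2 ^ suc n` unfolds to `2 ^ n + (2 ^ n + 0)`: one block for each half of the cube and a final
  -- empty one.
  with X₀ , Y , refl ← splitAt (2 ^ n) X
  with X₁ , [] , refl ← splitAt (2 ^ n) Y = begin
  card (members (suc n) X₀₁ ∘ (false ∷_)) + card (members (suc n) X₀₁ ∘ (true ∷_))
    ≡⟨ cong₂ _+_ (total-cong {n} λ v → cong ⟦_⟧ (lookup-++ˡ X₀ (X₁ ++ []) (enum v)))
                 (total-cong {n} λ v → cong ⟦_⟧ (trans (lookup-++ʳ X₀ (X₁ ++ []) (enum v Fin.↑ˡ 0))
                                                       (lookup-++ˡ X₁ [] (enum v)))) ⟩
  card (members n X₀) + card (members n X₁)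
    ≡⟨ cong₂ _+_ (card-members n X₀) (card-members n X₁) ⟩
  ∣ X₀ ∣ + ∣ X₁ ∣
    ≡⟨ cong (∣ X₀ ∣ +_) (trans (∣++∣ X₁ []) (+-identityʳ ∣ X₁ ∣)) ⟨
  ∣ X₀ ∣ + ∣ X₁ ++ [] ∣
    ≡⟨ ∣++∣ X₀ (X₁ ++ []) ⟨
  ∣ X₀₁ ∣ ∎
  where
  open ≡-Reasoning
  X₀₁ : Subset (2 ^ suc n)
  X₀₁ = X₀ ++ (X₁ ++ [])

-- A discrete intermediate value theorem; `large-bag` uses it to select the bag at which the number
-- of points still to come drops below `m`.
crossing : ∀ (c : ℕ → ℕ) m l → m ≤ c 0 → c l < m → ∃[ j ] (j < l × m ≤ c j × c (suc j) < m)
crossing c m zero    m≤c0 c0<m = contradiction m≤c0 (<⇒≱ c0<m)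
crossing c m (suc l) m≤c0 cl<m with m ≤? c l
... | yes m≤cl = l , ≤-refl , m≤cl , cl<m
... | no  m≰cl with j , j<l , h ← crossing c m l m≤c0 (≰⇒> m≰cl) = j , m≤n⇒m≤1+n j<l , h

-- The `true` half stays at `P` until the `false` half has been filled up to `Q`; the recursion
-- enters only the half being filled.
interpolate : ∀ (P Q : Family n) m → (∀ x → T (P x) → T (Q x)) → card P ≤ m → m ≤ card Q →
  ∃[ R ] ((∀ x → T (P x) → T (R x)) × (∀ x → T (R x) → T (Q x)) × card R ≡ m)
interpolate {zero} P Q m P⊆Q P≤m m≤Q with m ≟ card P
... | yes m≡ = P , (λ _ → id) , P⊆Q , sym m≡
... | no  m≢ = Q , P⊆Q , (λ _ → id) ,
  ≤-antisym (≤-trans (⟦⟧-mono {Q []} {true} _) (≤-trans (s≤s z≤n) (≤∧≢⇒< P≤m (m≢ ∘ sym)))) m≤Q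
interpolate {suc n} P Q m P⊆Q P≤m m≤Q with ≤-total m (card (Q ∘ (false ∷_)) + card (P ∘ (true ∷_)))
... | inj₁ m≤
  with R , P⊆R , R⊆Q , R≡ ← interpolate (P ∘ (false ∷_)) (Q ∘ (false ∷_)) (m ∸ card (P ∘ (true ∷_)))
       (λ x → P⊆Q (false ∷ x)) (m+n≤o⇒m≤o∸n _ P≤m) (m≤n+o⇒m∸n≤o m _ (≤-trans m≤ (≤-reflexive (+-comm (card (Q ∘ (false ∷_))) _))))
  = (λ { (false ∷ x) → R x ; (true ∷ x) → P (true ∷ x) })
  , (λ { (false ∷ x) → P⊆R x ; (true ∷ x) → id })
  , (λ { (false ∷ x) → R⊆Q x ; (true ∷ x) → P⊆Q (true ∷ x) })
  , trans (cong (_+ card (P ∘ (true ∷_))) R≡) (m∸n+n≡m (m+n≤o⇒n≤o (card (P ∘ (false ∷_))) P≤m))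
... | inj₂ ≤m
  with R , P⊆R , R⊆Q , R≡ ← interpolate (P ∘ (true ∷_)) (Q ∘ (true ∷_)) (m ∸ card (Q ∘ (false ∷_)))
       (λ x → P⊆Q (true ∷ x)) (m+n≤o⇒m≤o∸n _ (≤-trans (≤-reflexive (+-comm (card (P ∘ (true ∷_))) _)) ≤m)) (m≤n+o⇒m∸n≤o m _ m≤Q)
  = (λ { (false ∷ x) → Q (false ∷ x) ; (true ∷ x) → R x })
  , (λ { (false ∷ x) → P⊆Q (false ∷ x) ; (true ∷ x) → P⊆R x })
  , (λ { (false ∷ x) → id ; (true ∷ x) → R⊆Q x })
  , trans (cong (card (Q ∘ (false ∷_)) +_) R≡) (m+[n∸m]≡n (m+n≤o⇒m≤o (card (Q ∘ (false ∷_))) ≤m))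

ball-self : ∀ t {S : Family n} x → T (S x) → T (ball t S x)
ball-self zero    x x∈S = x∈S
ball-self (suc t) x x∈S = N-self x (ball-self t x x∈S)

<⇒toℕ : ∀ {j l} → j < l → ∃[ i ] j ≡ toℕ {l} i
<⇒toℕ j<l = fromℕ< j<l , sym (Fin.toℕ-fromℕ< j<l)

module _ {t n} (D : PathDecomposition (H₂ t n)) where

  open PathDecomposition D

  In : ℕ → Vec Bool n → Set
  In j v = ∃[ i ] (toℕ i < j × T (members n (bag i) v))

  in? : ∀ j v → Dec (In j v)
  in? j v = Fin.any? λ i → toℕ i <? j ×-dec T? (members n (bag i) v)

  -- As every vertex lies in some bag, these are the points that first occur in bag `j` or after it.
  later : ℕ → Family n
  later j v = ⌊ ¬? (in? j v) ⌋

  later⇒∉ : ∀ j v → T (later j v) → ¬ In j v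
  later⇒∉ j v = toWitness {a? = ¬? (in? j v)}

  ∉⇒later : ∀ j v → ¬ In j v → T (later j v)
  ∉⇒later j v = fromWitness {a? = ¬? (in? j v)}

  ∉later⇒In : ∀ j v → ¬ T (later j v) → In j v
  ∉later⇒In j v ∉later = decidable-stable (in? j v) (∉later ∘ ∉⇒later j v)

  later-suc : ∀ j v → T (later (suc j) v) → T (later j v)
  later-suc j v v∈ = ∉⇒later j v λ (i , i<j , v∈i) → later⇒∉ (suc j) v v∈ (i , m≤n⇒m≤1+n i<j , v∈i)

  later-0 : card (later 0) ≡ 2 ^ n
  later-0 = ≤-antisym (card≤2^n (later 0)) (≤-trans (≤-reflexive (sym (card-full {n})))
    (card-mono {S = λ _ → true} {later 0} λ x _ → ∉⇒later 0 x λ ()))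

  later-length : card (later length) ≡ 0
  later-length = card-empty {S = later length} λ v v∈ →
    let i , v∈i = vertex-cover v in later⇒∉ length v v∈ (i , Fin.toℕ<n i , ∈⇒members (bag i) v v∈i)

  module _ (i : Fin length) (R : Family n)
           (later⊆R : ∀ v → T (later (suc (toℕ i)) v) → T (R v))
           (R⊆later : ∀ v → T (R v) → T (later (toℕ i) v)) where

    -- The strict inequality gives a point of `R` that occurs by bag `i`; as a point of `R` it
    -- occurs in no earlier bag.
    pivot : card (later (suc (toℕ i))) < card R → ∃[ p ] (T (R p) × T (members n (bag i) p))
    pivot later<R with anyVec? (λ p → T? (R p) ×-dec ¬? (T? (later (suc (toℕ i)) p)))
    ... | no ∄p = contradiction
      (card-mono {S = R} {later (suc (toℕ i))} λ x x∈R → decidable-stable (T? _) λ x∉ → ∄p (x , x∈R , x∉))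
      (<⇒≱ later<R)
    ... | yes (p , p∈R , p∉) with i′ , i′≤i , p∈i′ ← ∉later⇒In (suc (toℕ i)) p p∉ with m≤n⇒m<n∨m≡n (s≤s⁻¹ i′≤i)
    ...   | inj₁ i′<i = contradiction (i′ , i′<i , p∈i′) (later⇒∉ (toℕ i) p (R⊆later p p∈R))
    ...   | inj₂ i′≡i = p , p∈R , subst (λ k → T (members n (bag k) p)) (Fin.toℕ-injective i′≡i) p∈i′

    -- Some bag up to `i` contains `v`. The point `w` of `R` near `v` occurs in no bag before `i`,
    -- so a bag shared by `v` and `w` has index at least `i`, and consecutiveness puts `v` into bag
    -- `i`.
    boundary⊆bag : ∀ v → T (ball t R v) → ¬ T (R v) → T (members n (bag i) v)
    boundary⊆bag v v∈ v∉R
      with w , w∈R , d≤t ← ball-elim t v v∈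
      with i₁ , i₁≤i , v∈i₁ ← ∉later⇒In (suc (toℕ i)) v (v∉R ∘ later⊆R v)
      with k , w∈k , v∈k ← edge-cover {w} {v} ((λ { refl → v∉R w∈R }) , d≤t)
      = ∈⇒members (bag i) v (consecutive {v} {i₁} {i} {k} (s≤s⁻¹ i₁≤i)
          (≮⇒≥ λ k<i → later⇒∉ (toℕ i) w (R⊆later w w∈R) (k , k<i , ∈⇒members (bag k) w w∈k))
          (members⇒∈ (bag i₁) v v∈i₁) v∈k)

    -- `R` and the bag cover the ball, and the pivot is counted twice. This gain of one offsets the
    -- difference between bag size and width.
    ball-bound : card (later (suc (toℕ i))) < card R → card (ball t R) < ∣ bag i ∣ + card R
    ball-bound later<R with p , p∈R , p∈i ← pivot later<R = begin-strict
      card (ball t R)                                 <⟨ total-mono-< cover p (strictly p∈R p∈i) ⟩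
      total (λ v → ⟦ members n (bag i) v ⟧ + ⟦ R v ⟧) ≡⟨ total-+ (⟦_⟧ ∘ members n (bag i)) (⟦_⟧ ∘ R) ⟩
      card (members n (bag i)) + card R               ≡⟨ cong (_+ card R) (card-members n (bag i)) ⟩
      ∣ bag i ∣ + card R                              ∎
      where
      open ≤-Reasoning
      cover : ∀ v → ⟦ ball t R v ⟧ ≤ ⟦ members n (bag i) v ⟧ + ⟦ R v ⟧
      cover v with T? (R v)
      ... | yes v∈R rewrite T⇒⟦⟧≡1 v∈R = ≤-trans (⟦⟧-mono {ball t R v} {true} _) (m≤n+m 1 _)
      ... | no v∉R = ≤-trans (⟦⟧-mono {ball t R v} {members n (bag i) v} λ v∈ → boundary⊆bag v v∈ v∉R) (m≤m+n _ _)
      strictly : ∀ {p} → T (R p) → T (members n (bag i) p) → ⟦ ball t R p ⟧ < ⟦ members n (bag i) p ⟧ + ⟦ R p ⟧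
      strictly {p} p∈R p∈i rewrite T⇒⟦⟧≡1 p∈R | T⇒⟦⟧≡1 p∈i = s≤s (⟦⟧-mono {ball t R p} {true} _)

  large-bag : ∀ m → 0 < m → m ≤ 2 ^ n → ∃[ i ] ∃[ R ] (card R ≡ m × card (ball t R) < ∣ bag i ∣ + m)
  large-bag m 0<m m≤2^n
    with j , j<l , m≤j , suc-j<m ← crossing (λ j → card (later j)) m length
      (≤-trans m≤2^n (≤-reflexive (sym later-0))) (≤-trans (s≤s (≤-reflexive later-length)) 0<m)
    with i , refl ← <⇒toℕ j<l
    with R , later⊆R , R⊆later , refl ← interpolate (later (suc (toℕ i))) (later (toℕ i)) m (later-suc (toℕ i)) (<⇒≤ suc-j<m) m≤j
    = i , R , refl , ball-bound i R later⊆R R⊆later suc-j<m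

pathwidth-lower : ∀ {t} (D : PathDecomposition (H₂ t n)) {k} → HasWidth (H₂ t n) D k →
                  ∀ (u v : Vec Bool n) → hamming u v ≤ t → rank v ≤ rank u + k
pathwidth-lower {n} {t} D {k} (_ , maximal) u v d≤t
  -- `suc (rank u)` is the size of the initial segment ending at `u`, the least size for which
  -- `ball-growth` applies to `u`.
  with i , R , card-R , bound ← large-bag D (suc (rank u)) z<s (rank<2^n u) = s≤s⁻¹ (s≤s⁻¹ (begin
  suc (suc (rank v))         ≤⟨ s≤s (ball-growth t R u v d≤t (≤-reflexive (sym card-R))) ⟩
  suc (card (ball t R))      ≤⟨ bound ⟩
  ∣ bag i ∣ + suc (rank u)   ≤⟨ +-monoˡ-≤ _ (maximal _ (i , refl)) ⟩
  suc k + suc (rank u)       ≡⟨ eq k (rank u) ⟩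
  suc (suc (rank u + k))     ∎))
  where
  open ≤-Reasoning
  open PathDecomposition D using (bag)
  eq : ∀ k r → suc k + suc r ≡ suc (suc (r + k))
  eq = solve-∀

-- Path decompositions from labellings

module Windows {t n} (f : Vec Bool n → ℕ) (f-inj : Injective _≡_ _≡_ f) (f<2^n : ∀ v → f v < 2 ^ n)
               {k} (k<2^n : k < 2 ^ n) (stretch : ∀ {u v} → hamming u v ≤ t → f v ≤ f u + k) where

  private
    module F = Counting f f-inj f<2^n

    -- The bags start at the labels from 0 to `2 ^ n - k - 1`, so the last bag ends exactly at the
    -- last label.
    length : ℕ
    length = 2 ^ n ∸ k

    Near : ℕ → ℕ → Set
    Near i a = i ≤ a × a ≤ i + k

    near? : ∀ i a → Dec (Near i a)
    near? i a = i ≤? a ×-dec a ≤? i + k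

    window-at : ℕ → Family n
    window-at i v = ⌊ near? i (f v) ⌋

    bag : Fin length → Subset (2 ^ n)
    bag i = tabulate (window-at (toℕ i) ∘ Inverse.from (binaryVectors↔ n))

    members-bag : ∀ i v → members n (bag i) v ≡ window-at (toℕ i) v
    members-bag i v = trans (lookup∘tabulate _ (enum v))
      (cong (window-at (toℕ i)) (Inverse.strictlyInverseʳ (binaryVectors↔ n) v))

    ∈bag : ∀ i v → Near (toℕ i) (f v) → enum v ∈ bag i
    ∈bag i v h = members⇒∈ (bag i) v (subst T (sym (members-bag i v)) (fromWitness {a? = near? (toℕ i) (f v)} h))

    ∈bag⁻¹ : ∀ i v → enum v ∈ bag i → Near (toℕ i) (f v)
    ∈bag⁻¹ i v h = toWitness {a? = near? (toℕ i) (f v)} (subst T (members-bag i v) (∈⇒members (bag i) v h))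

    cover : ∀ a b → a ≤ b → b ≤ a + k → b < 2 ^ n → ∃[ i ] (Near (toℕ {length} i) a × Near (toℕ i) b)
    cover a b a≤b b≤a+k b<2^n with <-≤-connex a length
    ... | inj₁ a<l with i , refl ← <⇒toℕ a<l = i , (≤-refl , m≤m+n _ k) , (a≤b , b≤a+k)
    -- No bag starts at `a`, so the last bag is taken.
    ... | inj₂ l≤a with i , eq ← <⇒toℕ {length ∸ 1} {length} (∸-monoʳ-< z<s (m<n⇒0<n∸m k<2^n)) =
      i , (i≤a , ≤-trans a≤b b≤i+k) , (≤-trans i≤a a≤b , b≤i+k)
      where
      open ≤-Reasoning
      i≤a : toℕ i ≤ a
      i≤a = ≤-trans (≤-reflexive (sym eq)) (≤-trans (m∸n≤m length 1) l≤a)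
      b≤i+k : b ≤ toℕ i + k
      b≤i+k = s≤s⁻¹ (begin
        suc b                  ≤⟨ b<2^n ⟩
        2 ^ n                  ≡⟨ m∸n+n≡m (<⇒≤ k<2^n) ⟨
        length + k             ≡⟨ cong (_+ k) (m+[n∸m]≡n (m<n⇒0<n∸m k<2^n)) ⟨
        suc (length ∸ 1) + k   ≡⟨ cong (λ j → suc j + k) eq ⟩
        suc (toℕ i + k)        ∎)

    card-window : ∀ i → i < length → card (window-at i) ≡ suc k
    card-window i i<l = +-cancelˡ-≡ i _ _ (begin
      i + card (window-at i)                 ≡⟨ cong (_+ card (window-at i)) (F.card-below (≤-trans (m≤m+n i (suc k)) i+k<2^n)) ⟨
      card (F.below i) + card (window-at i)  ≡⟨ total-+ (⟦_⟧ ∘ F.below i) (⟦_⟧ ∘ window-at i) ⟨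
      total (λ v → ⟦ F.below i v ⟧ + ⟦ window-at i v ⟧) ≡⟨ total-cong split ⟩
      card (F.below (i + suc k))             ≡⟨ F.card-below i+k<2^n ⟩
      i + suc k                              ∎)
      where
      open ≡-Reasoning
      i+k<2^n : i + suc k ≤ 2 ^ n
      i+k<2^n = ≤-trans (≤-reflexive (+-suc i k)) (≤-trans (+-monoˡ-≤ k i<l) (≤-reflexive (m∸n+n≡m (<⇒≤ k<2^n))))
      split : ∀ v → ⟦ F.below i v ⟧ + ⟦ window-at i v ⟧ ≡ ⟦ F.below (i + suc k) v ⟧
      split v with near? i (f v)
      ... | yes (i≤ , ≤i+k)
        rewrite ¬T⇒⟦⟧≡0 {f v <ᵇ i} (λ h → <⇒≱ (<ᵇ⇒< (f v) i h) i≤)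
              | T⇒⟦⟧≡1 {f v <ᵇ i + suc k} (<⇒<ᵇ (≤-trans (s≤s ≤i+k) (≤-reflexive (sym (+-suc i k))))) = refl
      ... | no ¬near = trans (+-identityʳ _) (≤-antisym
        (⟦⟧-mono {f v <ᵇ i} {f v <ᵇ i + suc k} λ h → <⇒<ᵇ (<-≤-trans (<ᵇ⇒< (f v) i h) (m≤m+n i (suc k))))
        (⟦⟧-mono {f v <ᵇ i + suc k} {f v <ᵇ i} λ h → <⇒<ᵇ (≰⇒> λ i≤ → ¬near (i≤ ,
          s≤s⁻¹ (≤-trans (<ᵇ⇒< (f v) _ h) (≤-reflexive (+-suc i k)))))))

    ∣bag∣ : ∀ i → ∣ bag i ∣ ≡ suc k
    ∣bag∣ i = trans (sym (card-members n (bag i)))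
      (trans (total-cong (cong ⟦_⟧ ∘ members-bag i)) (card-window (toℕ i) (Fin.toℕ<n i)))

  decomposition : PathDecomposition (H₂ t n)
  decomposition = record
    { length       = length
    ; bag          = bag
    ; vertex-cover = λ v → let i , near , _ = cover (f v) (f v) ≤-refl (m≤m+n _ k) (f<2^n v) in i , ∈bag i v near
    ; edge-cover   = edge-cover
    ; consecutive  = λ {v} {i} {j} {l} i≤j j≤l v∈i v∈l → ∈bag j v
        ( ≤-trans j≤l (proj₁ (∈bag⁻¹ l v v∈l))
        , ≤-trans (proj₂ (∈bag⁻¹ i v v∈i)) (+-monoˡ-≤ k i≤j) )
    }
    where
    edge-cover : ∀ {u v} → u ≢ v × hamming u v ≤ t → ∃[ i ] (enum u ∈ bag i × enum v ∈ bag i)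
    edge-cover {u} {v} (_ , d≤t) with ≤-total (f u) (f v)
    ... | inj₁ fu≤fv with i , near-u , near-v ← cover (f u) (f v) fu≤fv (stretch d≤t) (f<2^n v) =
      i , ∈bag i u near-u , ∈bag i v near-v
    ... | inj₂ fv≤fu with i , near-v , near-u ← cover (f v) (f u) fv≤fu
            (stretch (subst (_≤ t) (hamming-sym u v) d≤t)) (f<2^n u) =
      i , ∈bag i u near-u , ∈bag i v near-v

  hasWidth : HasWidth (H₂ t n) decomposition k
  hasWidth = (i , sym (∣bag∣ i)) , λ { _ (i , refl) → ≤-reflexive (∣bag∣ i) }
    where
    i : Fin length
    i = fromℕ< (m<n⇒0<n∸m k<2^n)

-- The rank labelling and its optimality

rankLabelling : ∀ t n → Labelling (H₂ t n)
rankLabelling t n = mk⤖ {to = toFin} (injective , λ i → surjective i)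
  where
  toFin : Vec Bool n → Fin (2 ^ n)
  toFin v = fromℕ< (rank<2^n v)
  injective : Injective _≡_ _≡_ toFin
  injective eq = rank-injective (Fin.fromℕ<-injective _ _ _ _ eq)
  surjective : ∀ i → ∃[ v ] (∀ {z} → z ≡ v → toFin z ≡ i)
  surjective i with v , eq ← Rank.surjective {n} (Fin.toℕ<n i) =
    v , λ { refl → Fin.toℕ-injective (trans (Fin.toℕ-fromℕ< (rank<2^n v)) eq) }

edgeLength-rank : ∀ t (u v : Vec Bool n) → edgeLength (H₂ t n) (rankLabelling t n) u v ≡ ∣ rank u - rank v ∣
edgeLength-rank t u v = cong₂ ∣_-_∣ (Fin.toℕ-fromℕ< (rank<2^n u)) (Fin.toℕ-fromℕ< (rank<2^n v))

∣rank-rank∣≤width : ∀ {t} (u v : Vec Bool n) → hamming u v ≤ t → ∣ rank u - rank v ∣ ≤ width t n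
∣rank-rank∣≤width {n} {t} u v d≤t with ≤-total (rank u) (rank v)
... | inj₁ u≤v = ≤-trans (≤-reflexive (m≤n⇒∣m-n∣≡n∸m u≤v)) (m≤n+o⇒m∸n≤o (rank v) (rank u) (rank-≤-hamming u v d≤t))
... | inj₂ v≤u = ≤-trans (≤-reflexive (m≤n⇒∣n-m∣≡n∸m v≤u))
  (m≤n+o⇒m∸n≤o (rank u) (rank v) (rank-≤-hamming v u (subst (_≤ t) (hamming-sym u v) d≤t)))

record Optimal (t n : ℕ) : Set where
  field
    source target : Vec Bool n
    near          : hamming source target ≤ t
    distinct      : source ≢ target
    rank-target   : rank target ≡ rank source + width t n

-- The endpoints differ in weight by `t`, which is positive, so they are distinct.
optimal : ∀ t d → 0 < t → Optimal t (d + t)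
optimal t d 0<t = record
  { source = source ; target = target ; near = near ; rank-target = rank-target
  ; distinct = λ eq → m<m+n⌊⌋ (trans (sym weight-source) (trans (cong weight eq) weight-target)) }
  where
  open ExtremalEdge (extremal t d)
  m<m+n⌊⌋ : ⌊ d /2⌋ ≢ ⌊ d /2⌋ + (d + t) ⊓ t
  m<m+n⌊⌋ = <⇒≢ (<-≤-trans (m<m+n ⌊ d /2⌋ 0<t) (≤-reflexive (cong (⌊ d /2⌋ +_) (sym (m≥n⇒m⊓n≡n (m≤n+m t d))))))

module _ {t n} (O : Optimal t n) where

  open Optimal O

  width<2^n : width t n < 2 ^ n
  width<2^n = ≤-<-trans (≤-trans (m≤n+m _ (rank source)) (≤-reflexive (sym rank-target))) (rank<2^n target)

  width-minimal : (D : PathDecomposition (H₂ t n)) → ∀ {k} → HasWidth (H₂ t n) D k → width t n ≤ k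
  width-minimal D hasWidth = +-cancelˡ-≤ (rank source) _ _
    (≤-trans (≤-reflexive (sym rank-target)) (pathwidth-lower D hasWidth source target near))

  isPathwidth : IsPathwidth (H₂ t n) (width t n)
  isPathwidth = (W.decomposition , W.hasWidth) , λ k (D , hasWidth) → width-minimal D hasWidth
    where
    module W = Windows {t} {n} rank rank-injective rank<2^n width<2^n (λ {u} {v} → rank-≤-hamming u v)

  hasStretch : HasStretch (H₂ t n) (rankLabelling t n) (width t n)
  hasStretch = (source , target , (distinct , near) , attained) ,
    λ { _ (u , v , (_ , d≤t) , refl) → ≤-trans (≤-reflexive (edgeLength-rank t u v)) (∣rank-rank∣≤width u v d≤t) }
    where
    attained : width t n ≡ edgeLength (H₂ t n) (rankLabelling t n) source target
    attained = sym (trans (edgeLength-rank t source target)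
      (trans (cong (λ r → ∣ rank source - r ∣) rank-target) (∣m-m+n∣≡n (rank source) (width t n))))

  stretch-minimal : ∀ k → ∃[ φ ] HasStretch (H₂ t n) φ k → width t n ≤ k
  stretch-minimal k (φ , (u , v , _ , k≡) , maximal) = width-minimal W.decomposition W.hasWidth
    where
    f : Vec Bool n → ℕ
    f = toℕ ∘ Bijection.to φ
    -- The stretch is attained, so it is a difference of two labels.
    k<2^n : k < 2 ^ n
    k<2^n = ≤-<-trans (≤-trans (≤-reflexive k≡) (∣m-n∣≤m⊔n (f u) (f v)))
      (⊔-pres-<m (Fin.toℕ<n (Bijection.to φ u)) (Fin.toℕ<n (Bijection.to φ v)))
    stretch : ∀ {u v} → hamming u v ≤ t → f v ≤ f u + k
    -- Maximality speaks of edges only, so coinciding points are treated apart.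
    stretch {u} {v} d≤t with f u ≟ f v
    ... | yes fu≡fv = ≤-trans (≤-reflexive (sym fu≡fv)) (m≤m+n _ k)
    ... | no fu≢fv = ≤-trans (m≤n+∣m-n∣ (f v) (f u)) (+-monoʳ-≤ (f u)
      (≤-trans (≤-reflexive (∣-∣-comm (f v) (f u))) (maximal _ (u , v , ((λ eq → fu≢fv (cong f eq)) , d≤t) , refl))))
    module W = Windows {t} {n} f (Bijection.injective φ ∘ Fin.toℕ-injective) (Fin.toℕ<n ∘ Bijection.to φ) k<2^n
                       (λ {u} {v} → stretch {u} {v})

  isBandwidth : IsBandwidth (H₂ t n) (width t n)
  isBandwidth = (rankLabelling t n , hasStretch) , stretch-minimal

-- The closed formula

-- Opened only here because +_ makes sections of the form (m +_) ambiguous.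
open import Data.Integer using (ℤ; 0ℤ; 1ℤ; +_)

-- Pascal's rule at the left end of the row: the first entry has a single parent, so one of the two
-- windows is shorter.
window-0 : ∀ k t → window (suc k) 0 (suc t) ≡ window k 0 t + window k 0 (suc t)
window-0 k t = begin
  window (suc k) 0 (suc t)              ≡⟨ ballSize-window (suc k) 0 (suc t) ⟨
  ballSize k (suc t) + ballSize k t     ≡⟨ cong₂ _+_ (ballSize-window k 0 (suc t)) (ballSize-window k 0 t) ⟩
  window k 0 (suc t) + window k 0 t     ≡⟨ +-comm (window k 0 (suc t)) _ ⟩
  window k 0 t + window k 0 (suc t)     ∎
  where open ≡-Reasoning

window-suc : ∀ k j t → window (suc k) (suc j) t ≡ window k j t + window k (suc j) t
window-suc k j zero    = refl
window-suc k j (suc t) = begin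
  window (suc k) (suc j) t + suc k C suc (j + t)
    ≡⟨ cong₂ _+_ (window-suc k j t) (sym (nCk+nC[k+1]≡[n+1]C[k+1] k (j + t))) ⟩
  window k j t + window k (suc j) t + (k C (j + t) + k C suc (j + t))
    ≡⟨ interchange +-commutativeSemigroup (window k j t) _ _ _ ⟩
  window k j t + k C (j + t) + (window k (suc j) t + k C suc (j + t)) ∎
  where open ≡-Reasoning

-- Every window is a whole row here, and rows 0 to `n - 1` add up to `2 ^ n - 1`, the sum of row `n`
-- without its last entry.
width-complete : ∀ t n → n ≤ t → width t n ≡ window n 0 n
width-complete t zero    _   = refl
width-complete t (suc n) n<t = begin
  width t n + window n (centre t n) t   ≡⟨ cong₂ _+_ (width-complete t n (<⇒≤ n<t)) (cong (λ a → window n a t) (cong ⌊_/2⌋ (m≤n⇒m∸n≡0 n<t))) ⟩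
  window n 0 n + window n 0 t           ≡⟨ cong (λ w → window n 0 n + w) full ⟩
  window n 0 n + window n 0 (suc n)     ≡⟨ window-0 n n ⟨
  window (suc n) 0 (suc n)              ∎
  where
  open ≡-Reasoning
  full : window n 0 t ≡ window n 0 (suc n)
  full = begin
    window n 0 t         ≡⟨ ballSize-window n 0 t ⟨
    ballSize n t         ≡⟨ trans (ballSize-full n n<t) (sym (ballSize-full n ≤-refl)) ⟩
    ballSize n (suc n)   ≡⟨ ballSize-window n 0 (suc n) ⟩
    window n 0 (suc n)   ∎

-- `k C (a ∸ 1)` would give 1 at `a = 0`, where the convention demands 0.
C-pred : ℕ → ℕ → ℕ
C-pred k zero    = 0
C-pred k (suc a) = k C a

-- By Pascal's rule the window of row `suc k` is the sum of those of row `k` starting at `a - 1` and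
-- `a`. Replacing the former by the latter trades `C-pred k a` for `k C (a + t)`; their difference
-- is the correction term.
window-double : ∀ k a t → window k a (suc t) + window k a (suc t) + C-pred k a
                        ≡ window (suc k) a (suc t) + k C (a + t)
window-double k zero t = begin
  window k 0 (suc t) + window k 0 (suc t) + 0   ≡⟨ eq (window k 0 t) (k C t) (window k 0 (suc t)) ⟩
  window k 0 t + window k 0 (suc t) + k C t     ≡⟨ cong (_+ k C t) (window-0 k t) ⟨
  window (suc k) 0 (suc t) + k C t              ∎
  where
  open ≡-Reasoning
  eq : ∀ a b c → a + b + c + 0 ≡ a + c + b
  eq = solve-∀
window-double k (suc a) t = begin
  w + w + k C a                        ≡⟨ +-assoc w w _ ⟩
  w + (w + k C a)                      ≡⟨ cong (λ v → w + v) (+-comm w _) ⟩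
  w + (k C a + w)                      ≡⟨ cong (λ v → w + v) (window-shift k a (suc t)) ⟨
  w + (w₀ + k C (a + suc t))           ≡⟨ +-assoc w w₀ _ ⟨
  w + w₀ + k C (a + suc t)             ≡⟨ cong₂ _+_ (trans (+-comm w w₀) (sym (window-suc k a (suc t)))) (cong (k C_) (+-suc a t)) ⟩
  window (suc k) (suc a) (suc t) + k C suc (a + t) ∎
  where
  open ≡-Reasoning
  w  = window k (suc a) (suc t)
  w₀ = window k a (suc t)

∑< : ℕ → (ℕ → ℤ) → ℤ
∑< zero    f = 0ℤ
∑< (suc l) f = ∑< l f ℤ.+ f l

foldr-snoc : ∀ (f : ℕ → ℤ) (h : ℕ → ℕ) l →
  foldr ℤ._+_ 0ℤ (List.map f (applyUpTo h (suc l))) ≡ foldr ℤ._+_ 0ℤ (List.map f (applyUpTo h l)) ℤ.+ f (h l)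
foldr-snoc f h zero    = ℤ.+-comm (f (h 0)) 0ℤ
foldr-snoc f h (suc l) = trans (cong (λ s → f (h 0) ℤ.+ s) (foldr-snoc f (h ∘ suc) l)) (sym (ℤ.+-assoc (f (h 0)) _ _))

foldr-∑< : ∀ (f : ℕ → ℤ) (h : ℕ → ℕ) l → foldr ℤ._+_ 0ℤ (List.map f (applyUpTo h l)) ≡ ∑< l (f ∘ h)
foldr-∑< f h zero    = refl
foldr-∑< f h (suc l) = trans (foldr-snoc f h l) (cong (ℤ._+ f (h l)) (foldr-∑< f h l))

∑<-window : ∀ k j l → ∑< l (λ i → binom k (+ (j + i))) ≡ + window k j l
∑<-window k j zero    = refl
∑<-window k j (suc l) = cong (ℤ._+ + (k C (j + l))) (∑<-window k j l)

correction : ℕ → ℕ → ℤ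
correction t a = binom (t + 2 * a) (+ (t + a) ℤ.- 1ℤ) ℤ.- binom (t + 2 * a) (+ a ℤ.- 1ℤ)

correction-suc : ∀ t a k → suc t + 2 * a ≡ k → correction (suc t) a ≡ + (k C (a + t)) ℤ.- + C-pred k a
correction-suc t zero    k refl = cong (λ j → + (k C j) ℤ.- 0ℤ) (+-identityʳ t)
correction-suc t (suc a) k refl = cong (λ j → + (k C j) ℤ.- + (k C a)) (+-comm t (suc a))

-- For even `d` the central window keeps its start and a correction arises, whose upper index is
-- matched by `2 * ⌊ d /2⌋ ≡ d`. For odd `d` the start advances.
⌊/2⌋-parity : ∀ d → (⌊ suc d /2⌋ ≡ ⌊ d /2⌋ × 2 * ⌊ d /2⌋ ≡ d) ⊎ ⌊ suc d /2⌋ ≡ suc ⌊ d /2⌋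
⌊/2⌋-parity zero          = inj₁ (refl , refl)
⌊/2⌋-parity (suc zero)    = inj₂ refl
⌊/2⌋-parity (suc (suc d)) with ⌊/2⌋-parity d
... | inj₁ (eq , even) = inj₁ (cong suc eq , trans (*-suc 2 ⌊ d /2⌋) (cong (λ e → suc (suc e)) even))
... | inj₂ eq          = inj₂ (cong suc eq)

-- Each step adds the next central window. For odd `d` it starts one place after the present one,
-- and the two merge by Pascal's rule; for even `d` they coincide, and `window-double` leaves a
-- correction.
width-formula : ∀ t d → + width (suc t) (d + suc t) ≡
                + window (d + suc t) ⌊ d /2⌋ (suc t) ℤ.+ ∑< ⌈ d /2⌉ (correction (suc t))
width-formula t zero    = trans (cong +_ (width-complete (suc t) (suc t) ≤-refl)) (sym (ℤ.+-identityʳ _))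
width-formula t (suc d) = begin
  + (width s k + window k (centre s k) s)
    ≡⟨ cong (λ c → + (width s k + window k ⌊ c /2⌋ s)) (m+n∸n≡m (suc d) s) ⟩
  + width s k ℤ.+ + window k ⌊ suc d /2⌋ s
    ≡⟨ cong (ℤ._+ + window k ⌊ suc d /2⌋ s) (width-formula t d) ⟩
  + window k ⌊ d /2⌋ s ℤ.+ K ⌊ suc d /2⌋ ℤ.+ + window k ⌊ suc d /2⌋ s
    ≡⟨ step ⟩
  + window (suc k) ⌊ suc d /2⌋ s ℤ.+ (K ⌊ d /2⌋ ℤ.+ correction s ⌊ d /2⌋) ∎
  where
  open ≡-Reasoning
  s = suc t
  k = d + s
  a = ⌊ d /2⌋
  K : ℕ → ℤ
  K l = ∑< l (correction s)
  regroup : ∀ w K x p → w ℤ.+ K ℤ.+ w ≡ w ℤ.+ w ℤ.+ p ℤ.- x ℤ.+ (K ℤ.+ (x ℤ.- p))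
  regroup = ℤ-solve.solve-∀
  cancel : ∀ w x → w ℤ.+ x ℤ.- x ≡ w
  cancel = ℤ-solve.solve-∀
  rotate : ∀ u L w → u ℤ.+ L ℤ.+ w ≡ (u ℤ.+ w) ℤ.+ L
  rotate = ℤ-solve.solve-∀
  step : + window k a s ℤ.+ K ⌊ suc d /2⌋ ℤ.+ + window k ⌊ suc d /2⌋ s ≡
         + window (suc k) ⌊ suc d /2⌋ s ℤ.+ (K a ℤ.+ correction s a)
  step with ⌊/2⌋-parity d
  ... | inj₂ odd rewrite odd = trans (rotate (+ window k a s) (K (suc a)) _)
    (cong (λ w → + w ℤ.+ K (suc a)) (sym (window-suc k a s)))
  ... | inj₁ (even , 2a≡d) rewrite even | correction-suc t a k (trans (cong (λ e → s + e) 2a≡d) (+-comm s d)) = begin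
    + w ℤ.+ K a ℤ.+ + w
      ≡⟨ regroup (+ w) (K a) (+ x) (+ p) ⟩
    + (w + w + p) ℤ.- + x ℤ.+ (K a ℤ.+ (+ x ℤ.- + p))
      ≡⟨ cong (λ y → + y ℤ.- + x ℤ.+ (K a ℤ.+ (+ x ℤ.- + p))) (window-double k a t) ⟩
    + window (suc k) a s ℤ.+ + x ℤ.- + x ℤ.+ (K a ℤ.+ (+ x ℤ.- + p))
      ≡⟨ cong (ℤ._+ (K a ℤ.+ (+ x ℤ.- + p))) (cancel (+ window (suc k) a s) (+ x)) ⟩
    + window (suc k) a s ℤ.+ (K a ℤ.+ (+ x ℤ.- + p)) ∎
    where
    w = window k a s
    x = k C (a + t)
    p = C-pred k a

n/2≡⌊n/2⌋ : ∀ n → n / 2 ≡ ⌊ n /2⌋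
n/2≡⌊n/2⌋ zero          = refl
n/2≡⌊n/2⌋ (suc zero)    = refl
n/2≡⌊n/2⌋ (suc (suc n)) = trans (m/n≡1+[m∸n]/n {suc (suc n)} {2} (s≤s (s≤s z≤n))) (cong suc (n/2≡⌊n/2⌋ n))

widthFormula≡window : ∀ t d → widthFormula (suc t) (suc d + suc t) ≡
  + window (suc d + suc t) ⌊ suc d /2⌋ (suc t) ℤ.+ ∑< ⌈ suc d /2⌉ (correction (suc t))
widthFormula≡window t d rewrite m+n∸n≡m (suc d) (suc t) | n/2≡⌊n/2⌋ (suc d) | n/2≡⌊n/2⌋ d =
  -- `⌈ suc d /2⌉` unfolds to `suc ⌊ d /2⌋`, the number of terms of a sum from 0 to `⌊ d /2⌋`.
  cong₂ ℤ._+_ first (foldr-∑< (correction (suc t)) id (suc ⌊ d /2⌋))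
  where
  k = suc d + suc t
  a = ⌊ suc d /2⌋
  len : suc (a + suc t ∸ 1) ∸ a ≡ suc t
  len = trans (cong (λ l → suc (l ∸ 1) ∸ a) (+-suc a t)) (trans (cong (_∸ a) (sym (+-suc a t))) (m+n∸m≡n a (suc t)))
  first : foldr ℤ._+_ 0ℤ (List.map (λ i → binom k (+ i)) (applyUpTo (λ i → a + i) (suc (a + suc t ∸ 1) ∸ a))) ≡ + window k a (suc t)
  first = trans (cong (λ l → foldr ℤ._+_ 0ℤ (List.map (λ i → binom k (+ i)) (applyUpTo (λ i → a + i) l))) len)
    (trans (foldr-∑< (λ i → binom k (+ i)) (λ i → a + i) (suc t)) (∑<-window k a (suc t)))

<⇒≡+ : ∀ {m n} → m < n → ∃[ d ] n ≡ suc d + m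
<⇒≡+ {m} {n} m<n = n ∸ suc m , sym (trans (sym (+-suc (n ∸ suc m) m)) (m∸n+n≡m m<n))

theorem1p1 : (t n : ℕ) → 0 < t → 0 < n → t < n →
    ∃[ pw ] ∃[ bw ] ( IsPathwidth (H₂ t n) pw × IsBandwidth (H₂ t n) bw
    × pw ≡ bw × + bw ≡ widthFormula t n )
theorem1p1 (suc t) n 0<t _ t<n with d , refl ← <⇒≡+ t<n =
  width (suc t) n , width (suc t) n , isPathwidth O , isBandwidth O , refl , 
  trans (width-formula t (suc d)) (sym (widthFormula≡window t d))
  where
  O = optimal (suc t) (suc d) 0<t
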